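{- For all $k\ge 1$ and all integers $n_1,\dots,n_k\ge 0$, $$\mathcal{L}_q\bigl(L_{n_1}(x;q)\cdots L_{n_k}(x;q)\bigr)=\sum_{\sigma\in\mathcal{D}(n_1,\dots,n_k)}y^{\mathrm{wex}(\sigma)}q^{\mathrm{cr}(\sigma)}.$$
   Context: Notation: $[n]_q=\frac{1-q^n}{1-q}$. The Al-Salam-Chihara polynomials $Q_n(x;\alpha,\beta|q)$ are defined by $Q_{ -1}=0$, $Q_0=1$, $Q_{n+1}(x)=(2x-(\alpha+\beta)q^n)Q_n(x)-(1-q^n)(1-\alpha\beta q^{n-1})Q_{n-1}(x)$. The $q$-Laguerre polynomials (depending on a parameter $y$) are $$L_n(x;q)=\left(\frac{\sqrt y}{q-1}\right)^nQ_n\left(\frac{(q-1)x+y+1}{2\sqrt y};\frac1{\sqrt y},\sqrt y\,q\,\Big|\,q\right),$$ and they satisfy $L_{ -1}(x;q)=0$, $L_0(x;q)=1$, $L_{n+1}(x;q)=(x-y[n+1]_q-[n]_q)L_n(x;q)-y[n]_q^2L_{n-1}(x;q)$. $S_n$ is the set of permutations of $[n]=\{1,\dots,n\}$. For $\sigma\in S_n$, $\mathrm{wex}(\sigma)=\#\{i: 1\le i\le n,\ i\le\sigma(i)\}$ (weak excedances) and $$\mathrm{cr}(\sigma)=\sum_{i=1}^n\#\{j: j<i\le\sigma(j)<\sigma(i)\}+\sum_{i=1}^n\#\{j: j>i>\sigma(j)>\sigma(i)\}$$ (crossings). $\mathcal{L}_q$ is the linear functional on polynomials in $x$ with $\mathcal{L}_q(x^n)=\sum_{\sigma\in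 S_n}y^{\mathrm{wex}(\sigma)}q^{\mathrm{cr}(\sigma)}$ for all $n\ge 0$ (so $\mathcal{L}_q(1)=1$). Given $n_1,\dots,n_k$ with $n=n_1+\cdots+n_k$, let $S_i$ (for $1\le i\le k$) be the segment of consecutive integers $\{n_1+\cdots+n_{i-1}+1,\dots,n_1+\cdots+n_i\}$, so that $[n]=S_1\cup\cdots\cup S_k$. $\mathcal{D}(n_1,\dots,n_k)$ is the set of permutations $\sigma$ of $[n]$ (generalized derangements) such that for every $i\in[n]$, $i$ and $\sigma(i)$ do not belong to the same segment $S_j$. -}

module Defs where

open import Algebra.Bundles using (CommutativeRing)
open import Data.Fin.Base using (Fin; zero; suc; punchIn; splitAt)
import Data.Fin.Properties as Fin
open import Data.Fin.Permutation as Perm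
  using (Permutation′; _⟨$⟩ʳ_; insert; remove; insert-remove; remove-insert; insert-punchIn)
open import Data.List.Base as List
  using (List; []; _∷_; [_]; length; filter; allFin; cartesianProductWith)
import Data.List.Membership.Setoid as Membership
open import Data.List.Membership.Setoid.Properties using (∈-cartesianProductWith⁺; ∈-resp-≈)
open import Data.List.Membership.Propositional.Properties using (∈-allFin)
open import Data.List.Relation.Unary.Any using (here)
open import Data.List.Relation.Unary.All as All using ()
open import Data.List.Relation.Unary.AllPairs using ([]; _∷_)
import Data.List.Relation.Unary.Unique.Setoid as Unique
import Data.List.Relation.Unary.Unique.Setoid.Properties as UniqueProperties
open import Data.List.Relation.Unary.Unique.Propositional.Properties using (allFin⁺)
open import Data.Nat.Base as ℕ using (ℕ; zero; suc)
open import Data.Nat.ListAction using (sum)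
open import Data.Product.Base using (_,_)
open import Data.Sum.Base using ([_,_]′)
open import Data.Vec.Base as Vec using (Vec; []; _∷_)
open import Function.Base using (_∘_; const)
open import Level using (Level; 0ℓ; _⊔_)
open import Relation.Binary.Bundles using (Setoid)
open import Relation.Binary.PropositionalEquality
  using (_≡_; _≢_; refl; sym; trans; cong; setoid)
open import Relation.Nullary.Decidable using (¬?; _×-dec_)
open import Relation.Unary using (Pred; Decidable)

-- The set {1,…,n} is modelled by Fin n, with its usual order.

count : ∀ {n} {P : Pred (Fin n) 0ℓ} → Decidable P → ℕ
count {n} P? = length (filter P? (allFin n))

wex : ∀ {n} → Permutation′ n → ℕ
wex σ = count (λ i → i Fin.≤? (σ ⟨$⟩ʳ i))

cr : ∀ {n} → Permutation′ n → ℕ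
cr {n} σ =
  sum (List.map upper (allFin n)) ℕ.+ sum (List.map lower (allFin n))
  where
  upper lower : Fin n → ℕ
  upper i = count λ j →
    (j Fin.<? i) ×-dec (i Fin.≤? (σ ⟨$⟩ʳ j)) ×-dec ((σ ⟨$⟩ʳ j) Fin.<? (σ ⟨$⟩ʳ i))
  lower i = count λ j →
    (i Fin.<? j) ×-dec ((σ ⟨$⟩ʳ j) Fin.<? i) ×-dec ((σ ⟨$⟩ʳ i) Fin.<? (σ ⟨$⟩ʳ j))

-- The index of the segment of consecutive elements containing a given element,
-- the segments having lengths n₁, …, n_k.

segment : ∀ {k} (ns : Vec ℕ k) → Fin (Vec.sum ns) → Fin k
segment (n ∷ ns) i = [ const zero , suc ∘ segment ns ]′ (splitAt n i)

IsGeneralizedDerangement : ∀ {k} (ns : Vec ℕ k) → Pred (Permutation′ (Vec.sum ns)) 0ℓ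
IsGeneralizedDerangement ns σ = ∀ i → segment ns i ≢ segment ns (σ ⟨$⟩ʳ i)

isGeneralizedDerangement? : ∀ {k} (ns : Vec ℕ k) → Decidable (IsGeneralizedDerangement ns)
isGeneralizedDerangement? ns σ =
  Fin.all? λ i → ¬? (segment ns i Fin.≟ segment ns (σ ⟨$⟩ʳ i))

-- Enumeration of the permutations of Fin n: choose the image j of 0 and a
-- bijection between the remaining elements. By permutations-complete and
-- permutations-unique each permutation occurs exactly once, up to pointwise
-- equality.

permutations : ∀ n → List (Permutation′ n)
permutations zero    = [ Perm.id ]
permutations (suc n) = cartesianProductWith (insert zero) (allFin (suc n)) (permutations n)

𝒟 : ∀ {k} (ns : Vec ℕ k) → List (Permutation′ (Vec.sum ns))
𝒟 ns = filter (isGeneralizedDerangement? ns) (permutations (Vec.sum ns))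

permutationSetoid : ℕ → Setoid 0ℓ 0ℓ
permutationSetoid n = record
  { Carrier       = Permutation′ n
  ; _≈_           = Perm._≈_
  ; isEquivalence = record
    { refl  = λ _ → refl
    ; sym   = λ p i → sym (p i)
    ; trans = λ p q i → trans (p i) (q i)
    }
  }

insert-cong : ∀ {n} {j j′ : Fin (suc n)} {σ τ : Permutation′ n} →
              j ≡ j′ → σ Perm.≈ τ → insert zero j σ Perm.≈ insert zero j′ τ
insert-cong refl p zero    = refl
insert-cong {j = j} {σ = σ} {τ = τ} refl p (suc i) =
  trans (insert-punchIn zero j σ i)
        (trans (cong (punchIn j) (p i)) (sym (insert-punchIn zero j τ i)))

remove-cong : ∀ {n} {σ τ : Permutation′ (suc n)} →
              σ Perm.≈ τ → remove zero σ Perm.≈ remove zero τ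
remove-cong {σ = σ} {τ} p i = Fin.punchIn-injective (σ ⟨$⟩ʳ zero) _ _
  (trans (sym (Perm.punchIn-permute σ zero i))
  (trans (p (suc i))
  (trans (Perm.punchIn-permute τ zero i)
         (cong (λ j → punchIn j (remove zero τ ⟨$⟩ʳ i)) (sym (p zero))))))

permutations-complete : ∀ {n} (σ : Permutation′ n) →
                        Membership._∈_ (permutationSetoid n) σ (permutations n)
permutations-complete {zero}  σ = here (λ ())
permutations-complete {suc n} σ =
  ∈-resp-≈ (permutationSetoid (suc n))
    {x = insert zero (σ ⟨$⟩ʳ zero) (remove zero σ)} {y = σ} (insert-remove zero σ)
    (∈-cartesianProductWith⁺ (setoid (Fin (suc n))) (permutationSetoid n)
      (permutationSetoid (suc n))
      (λ {j} {j′} {σ} {τ} → insert-cong {j = j} {j′} {σ} {τ})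
      (∈-allFin (σ ⟨$⟩ʳ zero)) (permutations-complete (remove zero σ)))

permutations-unique : ∀ n → Unique.Unique (permutationSetoid n) (permutations n)
permutations-unique zero    = All.[] ∷ []
permutations-unique (suc n) =
  UniqueProperties.cartesianProductWith⁺ (setoid (Fin (suc n))) (permutationSetoid n)
    (permutationSetoid (suc n)) (insert zero)
    (λ {i} {j} {σ} {τ} p → p zero , λ l →
      trans (sym (remove-insert zero i σ l))
      (trans (remove-cong {σ = insert zero i σ} {insert zero j τ} p l)
             (remove-insert zero j τ l)))
    (allFin⁺ (suc n)) (permutations-unique n)

-- The scalars: any commutative ring in which the definition of the
-- q-Laguerre polynomials makes sense, such as the field ℚ(√y, q).

record Parameters {c ℓ : Level} (R : CommutativeRing c ℓ) : Set (c ⊔ ℓ) where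
  open CommutativeRing R renaming (Carrier to K)
  field
    y q             : K
    √y √y⁻¹         : K
    ½ [q-1]⁻¹       : K
    √y-square       : √y * √y ≈ y
    √y-inverse      : √y * √y⁻¹ ≈ 1#
    2-inverse       : (1# + 1#) * ½ ≈ 1#
    [q-1]-inverse   : (q - 1#) * [q-1]⁻¹ ≈ 1#

-- A polynomial is the list of its coefficients, constant term first; trailing
-- zeros are allowed.

module Polynomials {c ℓ : Level} (R : CommutativeRing c ℓ) where
  open CommutativeRing R renaming (Carrier to K)

  infixl 6 _+ₚ_ _-ₚ_
  infixl 7 _*ₚ_ _·ₚ_
  infixl 8 _[_]ₚ

  Poly : Set c
  Poly = List K

  constant : K → Poly
  constant a = a ∷ []

  X : Poly
  X = 0# ∷ 1# ∷ []

  _+ₚ_ : Poly → Poly → Poly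
  []      +ₚ g       = g
  (a ∷ f) +ₚ []      = a ∷ f
  (a ∷ f) +ₚ (b ∷ g) = (a + b) ∷ (f +ₚ g)

  _·ₚ_ : K → Poly → Poly
  a ·ₚ f = List.map (a *_) f

  _-ₚ_ : Poly → Poly → Poly
  f -ₚ g = f +ₚ (- 1#) ·ₚ g

  _*ₚ_ : Poly → Poly → Poly
  []      *ₚ g = []
  (a ∷ f) *ₚ g = a ·ₚ g +ₚ (0# ∷ (f *ₚ g))

  -- f [ g ]ₚ is the composite f(g(x)).
  _[_]ₚ : Poly → Poly → Poly
  []      [ g ]ₚ = []
  (a ∷ f) [ g ]ₚ = constant a +ₚ g *ₚ (f [ g ]ₚ)

  productₚ : ∀ {k} → Vec Poly k → Poly
  productₚ = Vec.foldr′ _*ₚ_ (constant 1#)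

  -- The linear functional sending xⁿ to μ n.
  linearFunctional : (ℕ → K) → Poly → K
  linearFunctional μ []      = 0#
  linearFunctional μ (a ∷ f) = a * μ 0 + linearFunctional (μ ∘ suc) f

module AlSalamChihara {c ℓ : Level} (R : CommutativeRing c ℓ) where
  open CommutativeRing R renaming (Carrier to K)
  open import Algebra.Properties.Semiring.Exp semiring using (_^_)
  open Polynomials R

  Q : (α β q : K) → ℕ → Poly
  Q α β q zero          = constant 1#
  Q α β q (suc zero)    = (1# + 1#) ·ₚ X -ₚ constant ((α + β) * q ^ 0)
  Q α β q (suc (suc n)) =
    ((1# + 1#) ·ₚ X -ₚ constant ((α + β) * q ^ suc n)) *ₚ Q α β q (suc n)
      -ₚ ((1# - q ^ suc n) * (1# - α * β * q ^ n)) ·ₚ Q α β q n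

module QLaguerre {c ℓ : Level} (R : CommutativeRing c ℓ) (P : Parameters R) where
  open CommutativeRing R renaming (Carrier to K)
  open import Algebra.Properties.Semiring.Exp semiring using (_^_)
  open Parameters P
  open Polynomials R
  open AlSalamChihara R

  L : ℕ → Poly
  L n = ((√y * [q-1]⁻¹) ^ n) ·ₚ
        (Q √y⁻¹ (√y * q) q n
          [ (½ * √y⁻¹) ·ₚ ((q - 1#) ·ₚ X +ₚ constant (y + 1#)) ]ₚ)

  weight : ∀ {n} → Permutation′ n → K
  weight σ = y ^ wex σ * q ^ cr σ

  totalWeight : ∀ {n} → List (Permutation′ n) → K
  totalWeight σs = List.foldr _+_ 0# (List.map weight σs)

  ℒ : Poly → K
  ℒ = linearFunctional (λ n → totalWeight (permutations n))

{-# OPTIONS --safe #-}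
-- Reading the rows and columns 0, 1, 2, … of a permutation matrix from left to right, a
-- row i either meets a pending column j < i or becomes pending itself, and similarly for
-- columns. Meeting the pending row or column with k younger pending ones contributes k
-- crossings, so the weighted sum over permutations is computed by a transfer operator on
-- functions of the number h of pending rows (= pending columns). One element acts by
--   v ↦ v(h+1) + (y [h+1] + [h]) v(h) + y [h]² v(h−1),
-- whence ℒ(f) is f of this operator, applied to δ and evaluated at 0. A segment of n
-- elements without internal arcs acts by
--   v ↦ Σₘ Σₗ y^l q^((m−l)(m−l−1)/2) rₘ rₗ v(n+h−m−l),
-- where rₘ is the m-th q-rook number of the n × h rectangle.
-- This kernel is symmetric in n and h. Hence the three-term recurrence in h, which is the
-- action of one element, is also a three-term recurrence in n, and that is the recurrence
-- of the q-Laguerre polynomials: a segment of size n acts as L n.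
module Submission where

open import Defs
open import Level using (Level; _⊔_)
open import Algebra.Bundles using (CommutativeRing)
open import Data.Empty using (⊥; ⊥-elim)
open import Data.Fin.Base using (Fin; zero; suc; toℕ; punchIn; splitAt)
import Data.Fin.Properties as Fin
open import Data.Fin.Permutation using (Permutation′; _⟨$⟩ʳ_; insert; insert-punchIn)
open import Data.List.Base as List
  using (List; []; _∷_; _++_; length; filter; tabulate; allFin; cartesianProductWith)
open import Data.List.Properties using (length-++; ++-identityʳ; tabulate-cong; map-tabulate)
open import Data.List.Relation.Binary.Permutation.Propositional as ↭ using (_↭_; ↭-sym)
open import Data.List.Relation.Binary.Permutation.Propositional.Properties using (¬x∷xs↭[]; shift)
open import Data.List.Relation.Unary.All as All using (All; []; _∷_)
import Data.List.Relation.Unary.All.Properties as All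
open import Data.List.Relation.Unary.AllPairs using (AllPairs; []; _∷_)
import Data.List.Relation.Unary.AllPairs.Properties as AllPairs
open import Data.Nat.Base as ℕ using (ℕ; zero; suc; pred; _∸_; _≤_; _<_; _>_; _≥_)
open import Data.Nat.ListAction using (sum)
open import Data.Nat.Properties as ℕ using (_≤?_; _<?_)
open import Data.Nat.Tactic.RingSolver using (solve-∀)
open import Data.Product.Base using (_×_; _,_; proj₁; proj₂; ∃)
open import Data.Sum.Base using (inj₁; inj₂)
open import Data.Unit.Base using (⊤)
open import Data.Vec.Base as Vec using (Vec; []; _∷_; map)
open import Function.Base using (_∘_; id)
open import Relation.Binary.PropositionalEquality as ≡ using (_≡_; _≢_)
open import Relation.Nullary using (Dec; yes; no; ¬_)
open import Relation.Nullary.Decidable using (¬?; decidable-stable; _×-dec_)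
open import Relation.Unary using (Decidable)

-- Every crossing is charged to that one of its two arcs which closes first. At that moment the
-- other arc is known only through a younger pending row or column, and it makes the crossing
-- wherever it ends. Hence the past matters only through the number of pending elements, once edges
-- between two pending elements are given weight 0.
--
-- The exponent in the segment kernel is forced. Let m unread rows of the segment meet old columns
-- and l unread columns meet old rows. A row left pending is crossed at each of the l later
-- meetings, a column left pending at each of the m later ones, whereas the rook recursions supply
-- q^m for such a row and q^l for such a column. `gap` has the increments m - l that make up the
-- difference.
--
-- In closed form r_m(n,h) is the q-binomial of n over m times [h][h-1]⋯[h-m+1]. The rook identities
-- are equalities of sums, free of subtraction and division; truncated predecessors are harmless
-- because they come with the factor [0].

-- The transfer operators

-- gap m l = (m − l)(m − l − 1)/2.
gap : ℕ → ℕ → ℕ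
gap zero    zero    = 0
gap zero    (suc l) = suc l ℕ.+ gap zero l
gap (suc m) zero    = m ℕ.+ gap m zero
gap (suc m) (suc l) = gap m l

-- Subtraction-free form of gap(m+1,l) - gap(m,l) = m - l, the exchange of a factor q^m for a factor
-- q^l.
gap-sucˡ : ∀ m l → gap (suc m) l ℕ.+ l ≡ gap m l ℕ.+ m
gap-sucˡ m       zero    = ≡.trans (ℕ.+-identityʳ _) (ℕ.+-comm m _)
gap-sucˡ zero    (suc l) = ≡.trans (ℕ.+-comm _ (suc l)) (≡.sym (ℕ.+-identityʳ _))
gap-sucˡ (suc m) (suc l) =
  ≡.trans (ℕ.+-suc _ l) (≡.trans (≡.cong suc (gap-sucˡ m l)) (≡.sym (ℕ.+-suc _ m)))

gap-sucʳ : ∀ m l → gap m (suc l) ℕ.+ m ≡ suc (gap m l ℕ.+ l)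
gap-sucʳ zero    l       = ≡.trans (ℕ.+-identityʳ _) (≡.cong suc (ℕ.+-comm l _))
gap-sucʳ (suc m) zero    = ≡.trans (ℕ.+-suc _ m)
  (≡.cong suc (≡.trans (ℕ.+-comm _ m) (≡.sym (ℕ.+-identityʳ _))))
gap-sucʳ (suc m) (suc l) =
  ≡.trans (ℕ.+-suc _ m) (≡.cong suc (≡.trans (gap-sucʳ m l) (≡.sym (ℕ.+-suc _ l))))

module Operators {c ℓ : Level} (R : CommutativeRing c ℓ) (y q : CommutativeRing.Carrier R) where
  open CommutativeRing R renaming (Carrier to K)
  open import Algebra.Properties.Semiring.Exp semiring using (_^_; ^-homo-*; ^-congʳ)
  open import Algebra.Solver.Ring.NaturalCoefficients.Default commutativeSemiring
    using (solve; _:=_; _:+_; _:*_; con)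
  open import Relation.Binary.Reasoning.Setoid setoid

  [_] : ℕ → K
  [ zero ]  = 0#
  [ suc n ] = 1# + q * [ n ]

  -- rook n h f = Σₘ rₘ f(m), where rₘ is the m-th q-rook number of the n × h rectangle.
  rook : ℕ → ℕ → (ℕ → K) → K
  rook zero    h f = f 0
  rook (suc n) h f = rook n h (λ m → q ^ m * f m) + [ h ] * rook n (pred h) (f ∘ suc)

  rook-cong : ∀ n h {f g : ℕ → K} → (∀ m → f m ≈ g m) → rook n h f ≈ rook n h g
  rook-cong zero    h p = p 0
  rook-cong (suc n) h p =
    +-cong (rook-cong n h (λ m → *-congˡ (p m))) (*-congˡ (rook-cong n (pred h) (p ∘ suc)))

  rook-+ : ∀ n h (f g : ℕ → K) → rook n h (λ m → f m + g m) ≈ rook n h f + rook n h g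
  rook-+ zero    h f g = refl
  rook-+ (suc n) h f g = begin
    rook n h (λ m → q ^ m * (f m + g m)) + [ h ] * rook n (pred h) (λ m → f (suc m) + g (suc m))
      ≈⟨ +-cong (trans (rook-cong n h (λ m → distribˡ _ _ _)) (rook-+ n h _ _))
                (*-congˡ (rook-+ n (pred h) _ _)) ⟩
    (rook n h _ + rook n h _) + [ h ] * (rook n (pred h) (f ∘ suc) + rook n (pred h) (g ∘ suc))
      ≈⟨ solve 5 (λ a b h c d → (a :+ b) :+ h :* (c :+ d) := (a :+ h :* c) :+ (b :+ h :* d)) refl
           _ _ [ h ] _ _ ⟩
    rook (suc n) h f + rook (suc n) h g ∎

  rook-* : ∀ n h k (f : ℕ → K) → rook n h (λ m → k * f m) ≈ k * rook n h f
  rook-* zero    h k f = refl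
  rook-* (suc n) h k f = begin
    rook n h (λ m → q ^ m * (k * f m)) + [ h ] * rook n (pred h) (λ m → k * f (suc m))
      ≈⟨ +-cong (trans (rook-cong n h (λ m →
                  solve 3 (λ a k b → a :* (k :* b) := k :* (a :* b)) refl (q ^ m) k (f m)))
                  (rook-* n h k _))
                (*-congˡ (rook-* n (pred h) k _)) ⟩
    k * rook n h _ + [ h ] * (k * rook n (pred h) (f ∘ suc))
      ≈⟨ solve 4 (λ k a h b → k :* a :+ h :* (k :* b) := k :* (a :+ h :* b)) refl k _ [ h ] _ ⟩
    k * rook (suc n) h f ∎

  -- The q-analogue of m rₘ(n,h) = n h rₘ₋₁(n−1,h−1).
  rook-[m] : ∀ n h (f : ℕ → K) →
    rook n h (λ m → [ m ] * f m) ≈ [ h ] * [ n ] * rook (pred n) (pred h) (f ∘ suc)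
  rook-[m] zero    h f = solve 3 (λ a h b → con 0 :* a := h :* con 0 :* b) refl (f 0) [ h ] _
  rook-[m] (suc n) h f = begin
    rook n h (λ m → q ^ m * ([ m ] * f m)) + [ h ] * rook n (pred h) (λ m → (1# + q * [ m ]) * f (suc m))
      ≈⟨ +-cong (rook-cong n h λ m →
           solve 3 (λ a b c → a :* (b :* c) := b :* (a :* c)) refl (q ^ m) [ m ] (f m))
         (*-congˡ (rook-cong n (pred h) λ m →
           solve 3 (λ q m f → (con 1 :+ q :* m) :* f := f :+ q :* (m :* f)) refl q [ m ] (f (suc m)))) ⟩
    rook n h (λ m → [ m ] * (q ^ m * f m)) +
    [ h ] * rook n (pred h) (λ m → f (suc m) + q * ([ m ] * f (suc m)))
      ≈⟨ +-cong (rook-[m] n h _) (*-congˡ (trans (rook-+ n (pred h) _ _)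
           (+-congˡ (trans (rook-* n (pred h) q _) (*-congˡ (rook-[m] n (pred h) _)))))) ⟩
    [ h ] * [ n ] * rook (pred n) (pred h) (λ m → q ^ suc m * f (suc m)) +
    [ h ] * (rook n (pred h) (f ∘ suc) +
             q * ([ pred h ] * [ n ] * rook (pred n) (pred (pred h)) (λ m → f (suc (suc m)))))
      ≈⟨ +-congʳ (*-congˡ (trans (rook-cong (pred n) (pred h) (λ m → *-assoc _ _ _))
                                 (rook-* (pred n) (pred h) q _))) ⟩
    [ h ] * [ n ] * (q * rook (pred n) (pred h) (λ m → q ^ m * f (suc m))) +
    [ h ] * (rook n (pred h) (f ∘ suc) +
             q * ([ pred h ] * [ n ] * rook (pred n) (pred (pred h)) (λ m → f (suc (suc m)))))
      ≈⟨ solve 7 (λ h n q a b p c → h :* n :* (q :* a) :+ h :* (b :+ q :* (p :* n :* c)) :=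
                                   h :* (b :+ q :* (n :* (a :+ p :* c)))) refl
           [ h ] [ n ] q _ (rook n (pred h) (f ∘ suc)) [ pred h ] _ ⟩
    [ h ] * (rook n (pred h) (f ∘ suc) +
             q * ([ n ] * rook (suc (pred n)) (pred h) (f ∘ suc)))
      ≈⟨ *-congˡ (+-congˡ (*-congˡ (suc-pred n))) ⟩
    [ h ] * (rook n (pred h) (f ∘ suc) + q * ([ n ] * rook n (pred h) (f ∘ suc)))
      ≈⟨ solve 4 (λ h r q n → h :* (r :+ q :* (n :* r)) := h :* (con 1 :+ q :* n) :* r) refl
           [ h ] _ q [ n ] ⟩
    [ h ] * [ suc n ] * rook n (pred h) (f ∘ suc) ∎
    where
    suc-pred : ∀ n → [ n ] * rook (suc (pred n)) (pred h) (f ∘ suc) ≈ [ n ] * rook n (pred h) (f ∘ suc)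
    suc-pred zero    = trans (zeroˡ _) (sym (zeroˡ _))
    suc-pred (suc n) = refl

  -- Coefficientwise this is [n] = [m] + q^m [n-m] combined with [n-m] r_m(n,h) = [n] r_m(n-1,h).
  rook-predˡ : ∀ n h (f : ℕ → K) →
    [ n ] * rook (pred n) h (λ m → q ^ m * f m) + rook n h (λ m → [ m ] * f m) ≈ [ n ] * rook n h f
  rook-predˡ zero    h f = solve 2 (λ a b → con 0 :* a :+ con 0 :* b := con 0 :* b) refl _ (f 0)
  rook-predˡ (suc n) h f = begin
    [ suc n ] * A + (rook n h (λ m → q ^ m * ([ m ] * f m)) +
                     [ h ] * rook n (pred h) (λ m → (1# + q * [ m ]) * f (suc m)))
      ≈⟨ +-congˡ (+-cong
           (trans (rook-cong n h λ m →
             solve 3 (λ a b c → a :* (b :* c) := b :* (a :* c)) refl (q ^ m) [ m ] (f m))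
             (rook-[m] n h _))
           (*-congˡ (trans (rook-cong n (pred h) λ m →
             solve 3 (λ q m f → (con 1 :+ q :* m) :* f := f :+ q :* (m :* f)) refl q [ m ] (f (suc m)))
             (trans (rook-+ n (pred h) _ _) (+-congˡ (rook-* n (pred h) q _)))))) ⟩
    [ suc n ] * A + ([ h ] * [ n ] * rook (pred n) (pred h) (λ m → q ^ suc m * f (suc m)) +
                     [ h ] * (F + q * rook n (pred h) (λ m → [ m ] * f (suc m))))
      ≈⟨ +-congˡ (+-congʳ (*-congˡ (trans (rook-cong (pred n) (pred h) (λ m → *-assoc _ _ _))
                                          (rook-* (pred n) (pred h) q _)))) ⟩
    [ suc n ] * A + ([ h ] * [ n ] * (q * rook (pred n) (pred h) (λ m → q ^ m * f (suc m))) +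
                     [ h ] * (F + q * rook n (pred h) (λ m → [ m ] * f (suc m))))
      ≈⟨ solve 7 (λ n A h q b F c →
           (con 1 :+ q :* n) :* A :+ (h :* n :* (q :* b) :+ h :* (F :+ q :* c)) :=
           (con 1 :+ q :* n) :* A :+ h :* (F :+ q :* (n :* b :+ c))) refl
           [ n ] A [ h ] q _ F _ ⟩
    [ suc n ] * A + [ h ] * (F + q * ([ n ] * rook (pred n) (pred h) (λ m → q ^ m * f (suc m)) +
                                      rook n (pred h) (λ m → [ m ] * f (suc m))))
      ≈⟨ +-congˡ (*-congˡ (+-congˡ (*-congˡ (rook-predˡ n (pred h) (f ∘ suc))))) ⟩
    [ suc n ] * A + [ h ] * (F + q * ([ n ] * F))
      ≈⟨ solve 5 (λ n A h q F → (con 1 :+ q :* n) :* A :+ h :* (F :+ q :* (n :* F)) :=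
                                (con 1 :+ q :* n) :* (A :+ h :* F)) refl [ n ] A [ h ] q F ⟩
    [ suc n ] * rook (suc n) h f ∎
    where
    A = rook n h (λ m → q ^ m * f m)
    F = rook n (pred h) (f ∘ suc)

  -- The same with h in place of n: [h] = [m] + q^m [h-m] and [h-m] r_m(n,h) = [h] r_m(n,h-1).
  rook-predʳ : ∀ n h (f : ℕ → K) →
    [ h ] * rook n (pred h) (λ m → q ^ m * f m) + rook n h (λ m → [ m ] * f m) ≈ [ h ] * rook n h f
  rook-predʳ zero    h f =
    solve 2 (λ h a → h :* (con 1 :* a) :+ con 0 :* a := h :* a) refl [ h ] (f 0)
  rook-predʳ (suc n) h f = begin
    [ h ] * (rook n (pred h) (λ m → q ^ m * (q ^ m * f m)) + [ pred h ] * rook n (pred (pred h)) (λ m → q ^ suc m * f (suc m)))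
      + (rook n h (λ m → q ^ m * ([ m ] * f m)) + [ h ] * rook n (pred h) (λ m → (1# + q * [ m ]) * f (suc m)))
      ≈⟨ +-cong (*-congˡ (+-congˡ (*-congˡ (trans (rook-cong n (pred (pred h)) (λ m → *-assoc _ _ _))
                                                  (rook-* n (pred (pred h)) q _)))))
           (+-cong (rook-cong n h λ m →
             solve 3 (λ a b c → a :* (b :* c) := b :* (a :* c)) refl (q ^ m) [ m ] (f m))
           (*-congˡ (trans (rook-cong n (pred h) λ m →
             solve 3 (λ q m f → (con 1 :+ q :* m) :* f := f :+ q :* (m :* f)) refl q [ m ] (f (suc m)))
             (trans (rook-+ n (pred h) _ _) (+-congˡ (rook-* n (pred h) q _)))))) ⟩
    [ h ] * (rook n (pred h) (λ m → q ^ m * (q ^ m * f m)) + [ pred h ] * (q * rook n (pred (pred h)) (λ m → q ^ m * f (suc m))))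
      + (rook n h (λ m → [ m ] * (q ^ m * f m)) + [ h ] * (F + q * rook n (pred h) (λ m → [ m ] * f (suc m))))
      ≈⟨ solve 8 (λ h a p q b c F d → h :* (a :+ p :* (q :* b)) :+ (c :+ h :* (F :+ q :* d)) :=
                   (h :* a :+ c) :+ h :* (F :+ q :* (p :* b :+ d))) refl [ h ] _ [ pred h ] q _ _ F _ ⟩
    ([ h ] * rook n (pred h) (λ m → q ^ m * (q ^ m * f m)) + rook n h (λ m → [ m ] * (q ^ m * f m)))
      + [ h ] * (F + q * ([ pred h ] * rook n (pred (pred h)) (λ m → q ^ m * f (suc m)) + rook n (pred h) (λ m → [ m ] * f (suc m))))
      ≈⟨ +-cong (rook-predʳ n h _) (*-congˡ (+-congˡ (*-congˡ (rook-predʳ n (pred h) (f ∘ suc))))) ⟩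
    [ h ] * A + [ h ] * (F + q * ([ pred h ] * F))
      ≈⟨ +-congˡ (suc-pred h) ⟩
    [ h ] * A + [ h ] * ([ h ] * F)
      ≈⟨ distribˡ _ _ _ ⟨
    [ h ] * rook (suc n) h f ∎
    where
    A = rook n h (λ m → q ^ m * f m)
    F = rook n (pred h) (f ∘ suc)
    suc-pred : ∀ h {x} → [ h ] * (x + q * ([ pred h ] * x)) ≈ [ h ] * ([ h ] * x)
    suc-pred zero    = trans (zeroˡ _) (sym (zeroˡ _))
    suc-pred (suc h) = *-congˡ
      (solve 3 (λ x q h → x :+ q :* (h :* x) := (con 1 :+ q :* h) :* x) refl _ q [ h ])

  -- Both sides equal the sum of the two shortened terms and of Σ [m] r_m f(m), so this last sum is
  -- eliminated without subtracting it. This is the device that trades n for h in the recurrences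
  -- below.
  rook-exchange : ∀ n h (f : ℕ → K) →
    [ n ] * rook (pred n) h (λ m → q ^ m * f m) + [ h ] * rook n h f ≈
    [ h ] * rook n (pred h) (λ m → q ^ m * f m) + [ n ] * rook n h f
  rook-exchange n h f = begin
    a + [ h ] * rook n h f ≈⟨ +-congˡ (rook-predʳ n h f) ⟨
    a + (b + z)            ≈⟨ solve 3 (λ a b z → a :+ (b :+ z) := b :+ (a :+ z)) refl a b z ⟩
    b + (a + z)            ≈⟨ +-congˡ (rook-predˡ n h f) ⟩
    b + [ n ] * rook n h f ∎
    where
    a = [ n ] * rook (pred n) h (λ m → q ^ m * f m)
    b = [ h ] * rook n (pred h) (λ m → q ^ m * f m)
    z = rook n h (λ m → [ m ] * f m)

  -- The defining clause of `rook` with n and h interchanged, that is, the symmetry of the rook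
  -- numbers in recursive form.
  rook-sucʳ : ∀ n h (f : ℕ → K) →
    rook n (suc h) f ≈ rook n h (λ m → q ^ m * f m) + [ n ] * rook (pred n) h (f ∘ suc)
  rook-sucʳ zero    h f = solve 2 (λ a b → a := con 1 :* a :+ con 0 :* b) refl (f 0) _
  rook-sucʳ (suc n) h f = begin
    rook n (suc h) (λ m → q ^ m * f m) + [ suc h ] * F
      ≈⟨ +-congʳ (rook-sucʳ n h _) ⟩
    A + [ n ] * rook (pred n) h (λ m → q ^ suc m * f (suc m)) + [ suc h ] * F
      ≈⟨ +-congʳ (+-congˡ (*-congˡ (trans (rook-cong (pred n) h (λ m → *-assoc _ _ _))
                                          (rook-* (pred n) h q _)))) ⟩
    A + [ n ] * (q * rook (pred n) h (λ m → q ^ m * f (suc m))) + [ suc h ] * F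
      ≈⟨ solve 6 (λ A n q b h F → A :+ n :* (q :* b) :+ (con 1 :+ q :* h) :* F :=
                                  A :+ q :* (n :* b :+ h :* F) :+ F) refl A [ n ] q _ [ h ] F ⟩
    A + q * ([ n ] * rook (pred n) h (λ m → q ^ m * f (suc m)) + [ h ] * F) + F
      ≈⟨ +-congʳ (+-congˡ (*-congˡ (rook-exchange n h (f ∘ suc)))) ⟩
    A + q * ([ h ] * rook n (pred h) (λ m → q ^ m * f (suc m)) + [ n ] * F) + F
      ≈⟨ solve 6 (λ A n q b h F → A :+ q :* (h :* b :+ n :* F) :+ F :=
                                  A :+ h :* (q :* b) :+ (con 1 :+ q :* n) :* F) refl A [ n ] q _ [ h ] F ⟩
    A + [ h ] * (q * rook n (pred h) (λ m → q ^ m * f (suc m))) + [ suc n ] * F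
      ≈⟨ +-congʳ (+-congˡ (*-congˡ (trans (rook-cong n (pred h) (λ m → *-assoc _ _ _))
                                          (rook-* n (pred h) q _)))) ⟨
    rook (suc n) h (λ m → q ^ m * f m) + [ suc n ] * F ∎
    where
    A = rook n h (λ m → q ^ m * (q ^ m * f m))
    F = rook n h (f ∘ suc)

  -- Partly read segments and the segment kernel

  term : ℕ → ℕ → K → K
  term l e x = y ^ l * q ^ e * x

  absorb : ∀ l k e e′ x → k ℕ.+ e ≡ e′ → q ^ k * term l e x ≈ term l e′ x
  absorb l k e _ x ≡.refl = begin
    q ^ k * (y ^ l * q ^ e * x)
      ≈⟨ solve 4 (λ a b c x → a :* (b :* c :* x) := b :* (a :* c) :* x) refl (q ^ k) (y ^ l) (q ^ e) x ⟩
    y ^ l * (q ^ k * q ^ e) * x  ≈⟨ *-congʳ (*-congˡ (^-homo-* q k e)) ⟨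
    y ^ l * q ^ (k ℕ.+ e) * x ∎

  -- a and b count the pending rows and columns from before the current segment, c and d
  -- those belonging to it; n elements of the segment remain after a column, resp. n elements
  -- and one column after a row.
  afterC afterR : ℕ → (ℕ → K) → ℕ → ℕ → ℕ → ℕ → K
  afterC n v a c b d = rook n b λ m → rook n a λ l →
    term l (gap m l ℕ.+ (c ℕ.* l ℕ.+ d ℕ.* m)) (v (n ℕ.+ (a ℕ.+ c) ∸ (m ℕ.+ l)))
  afterR n v a c b d = rook n b λ m → rook (suc n) a λ l →
    term l (gap (suc m) l ℕ.+ (c ℕ.* l ℕ.+ d ℕ.* m)) (v (n ℕ.+ (a ℕ.+ c) ∸ (m ℕ.+ l)))

  -- A column is read. Either it becomes pending, or it meets one of the a old rows, at the price of
  -- y, of one crossing with each of the c new rows, and of [a] for the younger old ones. These are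
  -- the two summands of `rook (suc n) a`; in the first, `gap-sucˡ` turns q^l into q^m, the
  -- crossings of the new column with the m later meetings.
  afterR-step : ∀ n v a c b d →
    afterR n v a c b d ≈ afterC n v a c b (suc d) + y * q ^ c * [ a ] * afterC n v (pred a) c b d
  afterR-step n v a c b d = begin
    rook n b (λ m → rook n a (λ l → q ^ l * T m l) + [ a ] * rook n (pred a) (λ l → T m (suc l)))
      ≈⟨ rook-cong n b (λ m → +-cong
           (rook-cong n a (λ l → absorb l l _ _ _ (e₁ m l (gap-sucˡ m l))))
           (second m a)) ⟩
    rook n b (λ m → rook n a (λ l → term l (gap m l ℕ.+ (c ℕ.* l ℕ.+ suc d ℕ.* m)) (v (n ℕ.+ (a ℕ.+ c) ∸ (m ℕ.+ l))))
      + y * q ^ c * [ a ] * rook n (pred a) (λ l →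
          term l (gap m l ℕ.+ (c ℕ.* l ℕ.+ d ℕ.* m)) (v (n ℕ.+ (pred a ℕ.+ c) ∸ (m ℕ.+ l)))))
      ≈⟨ rook-+ n b _ _ ⟩
    afterC n v a c b (suc d) + rook n b (λ m → y * q ^ c * [ a ] * _)
      ≈⟨ +-congˡ (rook-* n b _ _) ⟩
    afterC n v a c b (suc d) + y * q ^ c * [ a ] * afterC n v (pred a) c b d ∎
    where
    T : ℕ → ℕ → K
    T m l = term l (gap (suc m) l ℕ.+ (c ℕ.* l ℕ.+ d ℕ.* m)) (v (n ℕ.+ (a ℕ.+ c) ∸ (m ℕ.+ l)))
    e₀ : ∀ l g c d m → l ℕ.+ (g ℕ.+ (c ℕ.* l ℕ.+ d ℕ.* m)) ≡ (g ℕ.+ l) ℕ.+ (c ℕ.* l ℕ.+ d ℕ.* m)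
    e₀ = solve-∀
    e₀′ : ∀ l g c d m → (g ℕ.+ m) ℕ.+ (c ℕ.* l ℕ.+ d ℕ.* m) ≡ g ℕ.+ (c ℕ.* l ℕ.+ suc d ℕ.* m)
    e₀′ = solve-∀
    e₁ : ∀ m l {g g′} → g′ ℕ.+ l ≡ g ℕ.+ m →
         l ℕ.+ (g′ ℕ.+ (c ℕ.* l ℕ.+ d ℕ.* m)) ≡ g ℕ.+ (c ℕ.* l ℕ.+ suc d ℕ.* m)
    e₁ m l {g} {g′} p = ≡.trans (e₀ l g′ c d m)
      (≡.trans (≡.cong (ℕ._+ (c ℕ.* l ℕ.+ d ℕ.* m)) p) (e₀′ l g c d m))
    e₂ : ∀ g c d l m → g ℕ.+ (c ℕ.* suc l ℕ.+ d ℕ.* m) ≡ c ℕ.+ (g ℕ.+ (c ℕ.* l ℕ.+ d ℕ.* m))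
    e₂ = solve-∀
    idx : ∀ a m l → n ℕ.+ (suc a ℕ.+ c) ∸ (m ℕ.+ suc l) ≡ n ℕ.+ (a ℕ.+ c) ∸ (m ℕ.+ l)
    idx a m l = ≡.cong₂ _∸_ (ℕ.+-suc n (a ℕ.+ c)) (ℕ.+-suc m l)
    second : ∀ m a →
      [ a ] * rook n (pred a) (λ l →
        term (suc l) (gap m l ℕ.+ (c ℕ.* suc l ℕ.+ d ℕ.* m)) (v (n ℕ.+ (a ℕ.+ c) ∸ (m ℕ.+ suc l)))) ≈
      y * q ^ c * [ a ] * rook n (pred a) (λ l →
        term l (gap m l ℕ.+ (c ℕ.* l ℕ.+ d ℕ.* m)) (v (n ℕ.+ (pred a ℕ.+ c) ∸ (m ℕ.+ l))))
    -- For a = 0 the truncated indices on the two sides disagree, but both sides carry [0].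
    second m zero    = solve 3 (λ x k z → con 0 :* x := k :* con 0 :* z) refl _ (y * q ^ c) _
    second m (suc a) = begin
      [ suc a ] * rook n a (λ l → term (suc l) (gap m l ℕ.+ (c ℕ.* suc l ℕ.+ d ℕ.* m)) (v (n ℕ.+ (suc a ℕ.+ c) ∸ (m ℕ.+ suc l))))
        ≈⟨ *-congˡ (rook-cong n a (λ l → trans
             (*-cong (trans (*-congˡ (^-congʳ q (e₂ (gap m l) c d l m))) (trans (*-congˡ (^-homo-* q c _))
               (solve 4 (λ y a b d → (y :* a) :* (b :* d) := (y :* b) :* (a :* d)) refl y (y ^ l) (q ^ c) _)))
               (reflexive (≡.cong v (idx a m l))))
             (*-assoc _ _ _))) ⟩
      [ suc a ] * rook n a (λ l → y * q ^ c * term l (gap m l ℕ.+ (c ℕ.* l ℕ.+ d ℕ.* m)) (v (n ℕ.+ (a ℕ.+ c) ∸ (m ℕ.+ l))))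
        ≈⟨ *-congˡ (rook-* n a _ _) ⟩
      [ suc a ] * (y * q ^ c * _)
        ≈⟨ solve 3 (λ a b c → a :* (b :* c) := b :* a :* c) refl [ suc a ] (y * q ^ c) _ ⟩
      y * q ^ c * [ suc a ] * _ ∎

  -- A row is read, with the two outcomes as the summands of `rook (suc n) b`. Meeting an old column
  -- costs q^d [b] without y, as the arc is no weak excedance. If the row becomes pending, q^m is
  -- turned into q^l for its crossings with the l later meetings.
  afterC-step : ∀ n v a c b d →
    afterC (suc n) v a c b d ≈ afterR n v a (suc c) b d + q ^ d * [ b ] * afterR n v a c (pred b) d
  afterC-step n v a c b d = +-cong
    (rook-cong n b λ m → trans (sym (rook-* (suc n) a _ _)) (rook-cong (suc n) a λ l →
      trans (absorb l m _ _ _ (e₁ m l (gap-sucˡ m l)))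
            (*-congˡ (reflexive (≡.cong (λ i → v (i ∸ (m ℕ.+ l))) (i₁ n a c))))))
    (begin
      [ b ] * rook n (pred b) (λ m → rook (suc n) a (λ l →
        term l (gap (suc m) l ℕ.+ (c ℕ.* l ℕ.+ d ℕ.* suc m)) (v (suc n ℕ.+ (a ℕ.+ c) ∸ (suc m ℕ.+ l)))))
        ≈⟨ *-congˡ (rook-cong n (pred b) λ m → trans (rook-cong (suc n) a λ l →
             sym (absorb l d _ _ _ (e₂ (gap (suc m) l) c d l m))) (rook-* (suc n) a _ _)) ⟩
      [ b ] * rook n (pred b) (λ m → q ^ d * _)
        ≈⟨ *-congˡ (rook-* n (pred b) _ _) ⟩
      [ b ] * (q ^ d * afterR n v a c (pred b) d)
        ≈⟨ solve 3 (λ a b c → a :* (b :* c) := b :* a :* c) refl [ b ] (q ^ d) _ ⟩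
      q ^ d * [ b ] * afterR n v a c (pred b) d ∎)
    where
    i₁ : ∀ n a c → suc n ℕ.+ (a ℕ.+ c) ≡ n ℕ.+ (a ℕ.+ suc c)
    i₁ = solve-∀
    e₀ : ∀ l g c d m → m ℕ.+ (g ℕ.+ (c ℕ.* l ℕ.+ d ℕ.* m)) ≡ (g ℕ.+ m) ℕ.+ (c ℕ.* l ℕ.+ d ℕ.* m)
    e₀ = solve-∀
    e₀′ : ∀ l g c d m → (g ℕ.+ l) ℕ.+ (c ℕ.* l ℕ.+ d ℕ.* m) ≡ g ℕ.+ (suc c ℕ.* l ℕ.+ d ℕ.* m)
    e₀′ = solve-∀
    e₁ : ∀ m l {g g′} → g′ ℕ.+ l ≡ g ℕ.+ m →
         m ℕ.+ (g ℕ.+ (c ℕ.* l ℕ.+ d ℕ.* m)) ≡ g′ ℕ.+ (suc c ℕ.* l ℕ.+ d ℕ.* m)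
    e₁ m l {g} {g′} p = ≡.trans (e₀ l g c d m)
      (≡.trans (≡.cong (ℕ._+ (c ℕ.* l ℕ.+ d ℕ.* m)) (≡.sym p)) (e₀′ l g′ c d m))
    e₂ : ∀ g c d l m → d ℕ.+ (g ℕ.+ (c ℕ.* l ℕ.+ d ℕ.* m)) ≡ g ℕ.+ (c ℕ.* l ℕ.+ d ℕ.* suc m)
    e₂ = solve-∀

  -- This is `afterC` at the start of a segment, with h old rows, h old columns and no new ones. The
  -- truncated subtraction is exact wherever both rook numbers are nonzero, since then m ≤ n and l ≤
  -- h.
  segmentOp : ℕ → (ℕ → K) → ℕ → K
  segmentOp n v h = rook n h λ m → rook n h λ l → term l (gap m l) (v (n ℕ.+ h ∸ (m ℕ.+ l)))

  afterC-start : ∀ n v h → afterC n v h 0 h 0 ≈ segmentOp n v h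
  afterC-start n v h = rook-cong n h λ m → rook-cong n h λ l →
    reflexive (≡.cong₂ (λ e i → term l e (v (n ℕ.+ i ∸ (m ℕ.+ l)))) (ℕ.+-identityʳ (gap m l)) (ℕ.+-identityʳ h))

  afterC-end : ∀ v a c b d → afterC 0 v a c b d ≈ v (a ℕ.+ c)
  afterC-end v a c b d = begin
    1# * q ^ (c ℕ.* 0 ℕ.+ d ℕ.* 0) * v (a ℕ.+ c)
      ≡⟨ ≡.cong (λ e → 1# * q ^ e * v (a ℕ.+ c)) (≡.cong₂ ℕ._+_ (ℕ.*-zeroʳ c) (ℕ.*-zeroʳ d)) ⟩
    1# * 1# * v (a ℕ.+ c)
      ≈⟨ solve 1 (λ x → con 1 :* con 1 :* x := x) refl _ ⟩
    v (a ℕ.+ c) ∎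

  segmentOp-cong : ∀ n {v w : ℕ → K} → (∀ i → v i ≈ w i) → ∀ h → segmentOp n v h ≈ segmentOp n w h
  segmentOp-cong n p h = rook-cong n h λ m → rook-cong n h λ l → *-congˡ (p _)

  -- The middle coefficient collects two cases. With y [h+1] the row becomes pending and the column
  -- meets one of h+1 rows, its own included, which is a fixed point. With [h] the row meets a
  -- column and the column becomes pending.
  elementOp : (ℕ → K) → ℕ → K
  elementOp w h = w (suc h) + (y * [ suc h ] + [ h ]) * w h + y * ([ h ] * [ h ]) * w (pred h)

  -- The first segment is the outermost operator, because the argument v is the value of what
  -- remains to be read.
  segmentOps : ∀ {k} → Vec ℕ k → (ℕ → K) → ℕ → K
  segmentOps []       v = v
  segmentOps (n ∷ ns) v = segmentOp n (segmentOps ns v)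

  -- The value when nothing is left to read: no element may still be pending.
  δ : ℕ → K
  δ zero    = 1#
  δ (suc _) = 0#

  elementPower : ℕ → (ℕ → K) → ℕ → K
  elementPower zero    v = v
  elementPower (suc m) v = elementOp (elementPower m v)

  segmentOp-zero : ∀ v h → segmentOp 0 v h ≈ v h
  segmentOp-zero v h = solve 1 (λ x → con 1 :* con 1 :* x := x) refl (v h)

  -- On the left h+1 is expanded by `rook-sucʳ` in both sums, on the right n+1 by definition. The
  -- summand `PE` is common, and the doubly shortened summands are the terms in n-1 and h-1. The
  -- mixed ones are matched by `rook-exchange`: in the inner sum against y [h+1] and y [n+1], in the
  -- outer sum against [h] and [n].
  segmentOp-recurrence : ∀ n v h → elementOp (segmentOp n v) h ≈
    segmentOp (suc n) v h + (y * [ suc n ] + [ n ]) * segmentOp n v h + y * ([ n ] * [ n ]) * segmentOp (pred n) v h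
  segmentOp-recurrence n v h = begin
    segmentOp n v (suc h) + (y * [ suc h ] + [ h ]) * Z + y * ([ h ] * [ h ]) * segmentOp n v (pred h)
      ≈⟨ +-cong (+-congʳ left) (sym (bb≈ h)) ⟩
    PE + [ n ] * Pa + ([ n ] * aE + [ n ] * ([ n ] * aa)) + (y * [ suc h ] + [ h ]) * Z + [ h ] * ([ h ] * bb h)
      ≈⟨ solve 11 (λ PE Pa aE aa Z bb n h y sh sn →
           PE :+ n :* Pa :+ (n :* aE :+ n :* (n :* aa)) :+ (y :* sh :+ h) :* Z :+ h :* (h :* bb) :=
           PE :+ (n :* Pa :+ y :* sh :* Z) :+ (n :* aE :+ h :* Z) :+ n :* (n :* aa) :+ h :* (h :* bb)) refl
           PE Pa aE aa Z (bb h) [ n ] [ h ] y [ suc h ] [ suc n ] ⟩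
    PE + ([ n ] * Pa + y * [ suc h ] * Z) + ([ n ] * aE + [ h ] * Z) + [ n ] * ([ n ] * aa) + [ h ] * ([ h ] * bb h)
      ≈⟨ +-congʳ (+-cong (+-cong (+-congˡ exchangeʳ) exchangeˡ) aa≈) ⟩
    PE + ([ h ] * Pb + y * [ suc n ] * Z) + ([ h ] * bE + [ n ] * Z) + y * ([ n ] * [ n ]) * segmentOp (pred n) v h + [ h ] * ([ h ] * bb h)
      ≈⟨ solve 11 (λ PE Pb bE aa Z bb n h y sn D →
           PE :+ (h :* Pb :+ y :* sn :* Z) :+ (h :* bE :+ n :* Z) :+ D :+ h :* (h :* bb) :=
           (PE :+ h :* Pb :+ (h :* bE :+ h :* (h :* bb))) :+ (y :* sn :+ n) :* Z :+ D) refl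
           PE Pb bE aa Z (bb h) [ n ] [ h ] y [ suc n ] _ ⟩
    PE + [ h ] * Pb + ([ h ] * bE + [ h ] * ([ h ] * bb h)) + (y * [ suc n ] + [ n ]) * Z + y * ([ n ] * [ n ]) * segmentOp (pred n) v h
      ≈⟨ +-congʳ (+-congʳ right) ⟨
    segmentOp (suc n) v h + (y * [ suc n ] + [ n ]) * Z + y * ([ n ] * [ n ]) * segmentOp (pred n) v h ∎
    where
    -- In the two-letter names the first letter refers to the sum over m and the second to the sum
    -- over l: a stands for n shortened by one, b for h shortened by one, P and E for no shortening.
    F F₀ : ℕ → ℕ → K
    F  m l = term l (gap m l) (v (suc (n ℕ.+ h) ∸ (m ℕ.+ l)))
    F₀ m l = term l (gap m l) (v (n ℕ.+ h ∸ (m ℕ.+ l)))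
    E A B A₀ B₀ : ℕ → K
    E m  = rook n h (λ l → q ^ l * F m l)
    A m  = rook (pred n) h (λ l → F m (suc l))
    B m  = rook n (pred h) (λ l → F m (suc l))
    A₀ m = rook (pred n) h (λ l → q ^ l * F₀ m l)
    B₀ m = rook n (pred h) (λ l → q ^ l * F₀ m l)
    Z PE Pa Pb aE aa bE : K
    Z  = segmentOp n v h
    PE = rook n h (λ m → q ^ m * E m)
    Pa = rook n h (λ m → q ^ m * A m)
    Pb = rook n h (λ m → q ^ m * B m)
    aE = rook (pred n) h (E ∘ suc)
    aa = rook (pred n) h (A ∘ suc)
    bE = rook n (pred h) (E ∘ suc)
    bb : ℕ → K
    bb h = rook n (pred h) (λ m → rook n (pred h) (λ l →
      term (suc l) (gap m l) (v (n ℕ.+ h ∸ (m ℕ.+ suc l)))))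

    left : segmentOp n v (suc h) ≈ PE + [ n ] * Pa + ([ n ] * aE + [ n ] * ([ n ] * aa))
    left = begin
      segmentOp n v (suc h)
        ≈⟨ rook-cong n (suc h) (λ m → trans
             (rook-cong n (suc h) λ l → *-congˡ (reflexive (≡.cong (λ i → v (i ∸ (m ℕ.+ l))) (ℕ.+-suc n h))))
             (rook-sucʳ n h (F m))) ⟩
      rook n (suc h) (λ m → E m + [ n ] * A m)
        ≈⟨ rook-sucʳ n h _ ⟩
      rook n h (λ m → q ^ m * (E m + [ n ] * A m)) + [ n ] * rook (pred n) h (λ m → E (suc m) + [ n ] * A (suc m))
        ≈⟨ +-cong (trans (rook-cong n h λ m → solve 4 (λ p e n a → p :* (e :+ n :* a) := p :* e :+ n :* (p :* a)) refl
                            (q ^ m) (E m) [ n ] (A m))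
                         (trans (rook-+ n h _ _) (+-congˡ (rook-* n h _ _))))
                  (trans (*-congˡ (trans (rook-+ (pred n) h _ _) (+-congˡ (rook-* (pred n) h _ _)))) (distribˡ _ _ _)) ⟩
      PE + [ n ] * Pa + ([ n ] * aE + [ n ] * ([ n ] * aa)) ∎

    right : segmentOp (suc n) v h ≈ PE + [ h ] * Pb + ([ h ] * bE + [ h ] * ([ h ] * bb h))
    right = begin
      rook n h (λ m → q ^ m * (E m + [ h ] * B m)) + [ h ] * rook n (pred h) (λ m → E (suc m) + [ h ] * B (suc m))
        ≈⟨ +-cong (trans (rook-cong n h λ m → solve 4 (λ p e n a → p :* (e :+ n :* a) := p :* e :+ n :* (p :* a)) refl
                            (q ^ m) (E m) [ h ] (B m))
                         (trans (rook-+ n h _ _) (+-congˡ (rook-* n h _ _))))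
                  (trans (*-congˡ (trans (rook-+ n (pred h) _ _) (+-congˡ (rook-* n (pred h) _ _)))) (distribˡ _ _ _)) ⟩
      PE + [ h ] * Pb + ([ h ] * bE + [ h ] * ([ h ] * bb h)) ∎

    -- By `gap-sucʳ`, raising l replaces q^m by q^l at the cost of q y. The factor q^l is what
    -- `rook-exchange` asks for in the inner sum, and q y fits y [h+1] = y + q y [h].
    scale : ∀ m l → q ^ m * F m (suc l) ≈ q * y * (q ^ l * F₀ m l)
    scale m l = begin
      q ^ m * F m (suc l)
        ≈⟨ absorb (suc l) m _ (suc (l ℕ.+ gap m l)) _
             (≡.trans (ℕ.+-comm m _) (≡.trans (gap-sucʳ m l) (≡.cong suc (ℕ.+-comm _ l)))) ⟩
      term (suc l) (suc (l ℕ.+ gap m l)) (v (suc (n ℕ.+ h) ∸ (m ℕ.+ suc l)))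
        ≈⟨ *-congˡ (reflexive (≡.cong (λ i → v (suc (n ℕ.+ h) ∸ i)) (ℕ.+-suc m l))) ⟩
      y * y ^ l * (q * q ^ (l ℕ.+ gap m l)) * v (n ℕ.+ h ∸ (m ℕ.+ l))
        ≈⟨ solve 5 (λ y a q b x → y :* a :* (q :* b) :* x := q :* y :* (a :* b :* x)) refl y (y ^ l) q _ _ ⟩
      q * y * term l (l ℕ.+ gap m l) (v (n ℕ.+ h ∸ (m ℕ.+ l)))
        ≈⟨ *-congˡ (absorb l l _ _ _ ≡.refl) ⟨
      q * y * (q ^ l * F₀ m l) ∎

    PA : Pa ≈ q * y * rook n h A₀
    PA = trans (rook-cong n h λ m → trans (sym (rook-* (pred n) h _ _))
           (trans (rook-cong (pred n) h (scale m)) (rook-* (pred n) h _ _))) (rook-* n h _ _)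

    PB : Pb ≈ q * y * rook n h B₀
    PB = trans (rook-cong n h λ m → trans (sym (rook-* n (pred h) _ _))
           (trans (rook-cong n (pred h) (scale m)) (rook-* n (pred h) _ _))) (rook-* n h _ _)

    exchange₀ : [ n ] * rook n h A₀ + [ h ] * Z ≈ [ h ] * rook n h B₀ + [ n ] * Z
    exchange₀ = begin
      [ n ] * rook n h A₀ + [ h ] * Z
        ≈⟨ +-cong (rook-* n h _ _) (rook-* n h _ _) ⟨
      rook n h (λ m → [ n ] * A₀ m) + rook n h (λ m → [ h ] * rook n h (F₀ m))
        ≈⟨ rook-+ n h _ _ ⟨
      rook n h (λ m → [ n ] * A₀ m + [ h ] * rook n h (F₀ m))
        ≈⟨ rook-cong n h (λ m → rook-exchange n h (F₀ m)) ⟩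
      rook n h (λ m → [ h ] * B₀ m + [ n ] * rook n h (F₀ m))
        ≈⟨ rook-+ n h _ _ ⟩
      rook n h (λ m → [ h ] * B₀ m) + rook n h (λ m → [ n ] * rook n h (F₀ m))
        ≈⟨ +-cong (rook-* n h _ _) (rook-* n h _ _) ⟩
      [ h ] * rook n h B₀ + [ n ] * Z ∎

    exchangeʳ : [ n ] * Pa + y * [ suc h ] * Z ≈ [ h ] * Pb + y * [ suc n ] * Z
    exchangeʳ = begin
      [ n ] * Pa + y * [ suc h ] * Z
        ≈⟨ +-congʳ (*-congˡ PA) ⟩
      [ n ] * (q * y * rook n h A₀) + y * [ suc h ] * Z
        ≈⟨ solve 6 (λ n q y a h z → n :* (q :* y :* a) :+ y :* (con 1 :+ q :* h) :* z :=
                                    q :* y :* (n :* a :+ h :* z) :+ y :* z) refl [ n ] q y _ [ h ] Z ⟩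
      q * y * ([ n ] * rook n h A₀ + [ h ] * Z) + y * Z
        ≈⟨ +-congʳ (*-congˡ exchange₀) ⟩
      q * y * ([ h ] * rook n h B₀ + [ n ] * Z) + y * Z
        ≈⟨ solve 6 (λ n q y a h z → h :* (q :* y :* a) :+ y :* (con 1 :+ q :* n) :* z :=
                                    q :* y :* (h :* a :+ n :* z) :+ y :* z) refl [ n ] q y _ [ h ] Z ⟨
      [ h ] * (q * y * rook n h B₀) + y * [ suc n ] * Z
        ≈⟨ +-congʳ (*-congˡ PB) ⟨
      [ h ] * Pb + y * [ suc n ] * Z ∎

    -- Raising m replaces q^l by q^m, which leaves the inner sum and is the power that
    -- `rook-exchange` asks for in the outer one.
    E-suc : ∀ m → E (suc m) ≈ q ^ m * rook n h (F₀ m)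
    E-suc m = trans (rook-cong n h λ l → trans
      (absorb l l _ (m ℕ.+ gap m l) _ (≡.trans (ℕ.+-comm l _) (≡.trans (gap-sucˡ m l) (ℕ.+-comm _ m))))
      (sym (absorb l m _ _ _ ≡.refl))) (rook-* n h _ _)

    exchangeˡ : [ n ] * aE + [ h ] * Z ≈ [ h ] * bE + [ n ] * Z
    exchangeˡ = begin
      [ n ] * aE + [ h ] * Z  ≈⟨ +-congʳ (*-congˡ (rook-cong (pred n) h E-suc)) ⟩
      _                       ≈⟨ rook-exchange n h (λ m → rook n h (F₀ m)) ⟩
      _                       ≈⟨ +-congʳ (*-congˡ (rook-cong n (pred h) E-suc)) ⟨
      [ h ] * bE + [ n ] * Z  ∎

    term-suc : ∀ l e {x x′} → x ≡ x′ → term (suc l) e x ≈ y * term l e x′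
    term-suc l e ≡.refl = solve 4 (λ y a b x → y :* a :* b :* x := y :* (a :* b :* x)) refl y (y ^ l) (q ^ e) _

    bb≈ : ∀ h → [ h ] * ([ h ] * bb h) ≈ y * ([ h ] * [ h ]) * segmentOp n v (pred h)
    bb≈ zero    = solve 3 (λ b y x → con 0 :* (con 0 :* b) := y :* (con 0 :* con 0) :* x) refl (bb 0) y _
    bb≈ (suc h) = begin
      [ suc h ] * ([ suc h ] * bb (suc h))
        ≈⟨ *-congˡ (*-congˡ (trans (rook-cong n h λ m → trans (rook-cong n h λ l →
             term-suc l (gap m l) (≡.cong v (≡.cong₂ _∸_ (ℕ.+-suc n h) (ℕ.+-suc m l)))) (rook-* n h _ _))
             (rook-* n h _ _))) ⟩
      [ suc h ] * ([ suc h ] * (y * segmentOp n v h))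
        ≈⟨ solve 3 (λ h y x → h :* (h :* (y :* x)) := y :* (h :* h) :* x) refl [ suc h ] y _ ⟩
      y * ([ suc h ] * [ suc h ]) * segmentOp n v h ∎

    aa≈ : [ n ] * ([ n ] * aa) ≈ y * ([ n ] * [ n ]) * segmentOp (pred n) v h
    aa≈ = go n
      where
      go : ∀ n → [ n ] * ([ n ] * rook (pred n) h (λ m → rook (pred n) h (λ l →
             term (suc l) (gap m l) (v (n ℕ.+ h ∸ (m ℕ.+ suc l)))))) ≈ y * ([ n ] * [ n ]) * segmentOp (pred n) v h
      go zero    = solve 3 (λ b y x → con 0 :* (con 0 :* b) := y :* (con 0 :* con 0) :* x) refl _ y _
      go (suc n) = begin
        [ suc n ] * ([ suc n ] * _)
          ≈⟨ *-congˡ (*-congˡ (trans (rook-cong n h λ m → trans (rook-cong n h λ l →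
               term-suc l (gap m l) (≡.cong (λ i → v (suc n ℕ.+ h ∸ i)) (ℕ.+-suc m l))) (rook-* n h _ _))
               (rook-* n h _ _))) ⟩
        [ suc n ] * ([ suc n ] * (y * segmentOp n v h))
          ≈⟨ solve 3 (λ h y x → h :* (h :* (y :* x)) := y :* (h :* h) :* x) refl [ suc n ] y _ ⟩
        y * ([ suc n ] * [ suc n ]) * segmentOp n v h ∎

-- Sums over the matchings of two lists

-- The pairs of a chosen element and the remaining list over which `∑pick` runs. A `Pick` carries
-- facts about the whole list to the single summands.
data Pick {A : Set} : List A → A → List A → Set where
  here  : ∀ {x xs} → Pick (x ∷ xs) x xs
  there : ∀ {x xs z zs} → Pick xs z zs → Pick (x ∷ xs) z (x ∷ zs)

Pick-All : ∀ {p} {A : Set} {P : A → Set p} {xs z zs} → Pick xs z zs → All P xs → P z × All P zs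
Pick-All here      (p ∷ ps) = p , ps
Pick-All (there k) (p ∷ ps) = proj₁ (Pick-All k ps) , p ∷ proj₂ (Pick-All k ps)

Pick-length : ∀ {A : Set} {xs zs : List A} {z} → Pick xs z zs → length xs ≡ suc (length zs)
Pick-length here      = ≡.refl
Pick-length (there k) = ≡.cong suc (Pick-length k)

Pick-AllPairs : ∀ {xs zs : List ℕ} {z} → Pick xs z zs → AllPairs _>_ xs → AllPairs _>_ zs
Pick-AllPairs here      (p ∷ ps) = ps
Pick-AllPairs (there k) (p ∷ ps) = proj₂ (Pick-All k p) ∷ Pick-AllPairs k ps

module Sums {c ℓ : Level} (R : CommutativeRing c ℓ) where
  open CommutativeRing R hiding (zero) renaming (Carrier to K)
  open import Algebra.Solver.Ring.NaturalCoefficients.Default commutativeSemiring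
    using (solve; _:=_; _:+_; _:*_)
  open import Relation.Binary.Reasoning.Setoid setoid

  private
    variable
      A B : Set

  Π : (A → K) → List A → K
  Π f []       = 1#
  Π f (x ∷ xs) = f x * Π f xs

  Π-cong : ∀ {p} {P : A → Set p} {f g : A → K} → (∀ {x} → P x → f x ≈ g x) →
           ∀ {xs} → All P xs → Π f xs ≈ Π g xs
  Π-cong p []         = refl
  Π-cong p (px ∷ pxs) = *-cong (p px) (Π-cong p pxs)

  Π-1 : (xs : List A) → Π (λ _ → 1#) xs ≈ 1#
  Π-1 []       = refl
  Π-1 (x ∷ xs) = trans (*-identityˡ _) (Π-1 xs)

  Π-++ : (f : A → K) (xs {ys} : List A) → Π f (xs ++ ys) ≈ Π f xs * Π f ys
  Π-++ f []       = sym (*-identityˡ _)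
  Π-++ f (x ∷ xs) = trans (*-congˡ (Π-++ f xs)) (sym (*-assoc _ _ _))

  Π-* : (f g : A → K) (xs : List A) → Π (λ x → f x * g x) xs ≈ Π f xs * Π g xs
  Π-* f g []       = sym (*-identityˡ _)
  Π-* f g (x ∷ xs) = trans (*-congˡ (Π-* f g xs))
    (solve 4 (λ a b c d → a :* b :* (c :* d) := a :* c :* (b :* d)) refl (f x) (g x) _ _)

  Π-↭ : (f : A → K) {xs ys : List A} → xs ↭ ys → Π f xs ≈ Π f ys
  Π-↭ f ↭.refl         = refl
  Π-↭ f (↭.prep x p)   = *-congˡ (Π-↭ f p)
  Π-↭ f (↭.swap x y p) = trans (*-congˡ (*-congˡ (Π-↭ f p)))
    (solve 3 (λ a b c → a :* (b :* c) := b :* (a :* c)) refl (f x) (f y) _)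
  Π-↭ f (↭.trans p p′) = trans (Π-↭ f p) (Π-↭ f p′)

  ∑pick : List A → (A → List A → K) → K
  ∑pick []       g = 0#
  ∑pick (x ∷ xs) g = g x xs + ∑pick xs (λ z zs → g z (x ∷ zs))

  ∑pick-cong : ∀ (xs : List A) {g g′} → (∀ {z zs} → Pick xs z zs → g z zs ≈ g′ z zs) →
               ∑pick xs g ≈ ∑pick xs g′
  ∑pick-cong []       p = refl
  ∑pick-cong (x ∷ xs) p = +-cong (p here) (∑pick-cong xs (p ∘ there))

  ∑pick-0 : (xs : List A) → ∑pick xs (λ _ _ → 0#) ≈ 0#
  ∑pick-0 []       = refl
  ∑pick-0 (x ∷ xs) = trans (+-identityˡ _) (∑pick-0 xs)

  ∑pick-+ : (xs : List A) (g g′ : A → List A → K) →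
            ∑pick xs (λ z zs → g z zs + g′ z zs) ≈ ∑pick xs g + ∑pick xs g′
  ∑pick-+ []       g g′ = sym (+-identityˡ _)
  ∑pick-+ (x ∷ xs) g g′ = trans (+-congˡ (∑pick-+ xs _ _))
    (solve 4 (λ a b c d → a :+ b :+ (c :+ d) := a :+ c :+ (b :+ d)) refl (g x xs) (g′ x xs) _ _)

  ∑pick-* : (xs : List A) (k : K) (g : A → List A → K) →
            ∑pick xs (λ z zs → k * g z zs) ≈ k * ∑pick xs g
  ∑pick-* []       k g = sym (zeroʳ k)
  ∑pick-* (x ∷ xs) k g = trans (+-congˡ (∑pick-* xs k _)) (sym (distribˡ k _ _))

  ∑pick-++ : (xs ys : List A) (g : A → List A → K) → ∑pick (xs ++ ys) g ≈
             ∑pick xs (λ z zs → g z (zs ++ ys)) + ∑pick ys (λ z zs → g z (xs ++ zs))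
  ∑pick-++ []       ys g = sym (+-identityˡ _)
  ∑pick-++ (x ∷ xs) ys g = trans (+-congˡ (∑pick-++ xs ys _)) (sym (+-assoc _ _ _))

  ∑pick-comm : (xs : List A) (ys : List B) (g : A → List A → B → List B → K) →
    ∑pick xs (λ x xs′ → ∑pick ys (λ y ys′ → g x xs′ y ys′)) ≈
    ∑pick ys (λ y ys′ → ∑pick xs (λ x xs′ → g x xs′ y ys′))
  ∑pick-comm []       ys g = sym (∑pick-0 ys)
  ∑pick-comm (x ∷ xs) ys g = trans (+-congˡ (∑pick-comm xs ys _)) (sym (∑pick-+ ys _ _))

  ∑pick-swap : (xs : List A) (g : A → A → List A → K) →
    ∑pick xs (λ x xs′ → ∑pick xs′ (λ z zs → g x z zs)) ≈
    ∑pick xs (λ z xs′ → ∑pick xs′ (λ x zs → g x z zs))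
  ∑pick-swap []       g = refl
  ∑pick-swap (x ∷ xs) g = begin
    ∑pick xs (g x) + ∑pick xs (λ z zs → g z x zs + ∑pick zs (λ z′ zs′ → g z z′ (x ∷ zs′)))
      ≈⟨ +-congˡ (trans (∑pick-+ xs _ _) (+-congˡ (∑pick-swap xs _))) ⟩
    ∑pick xs (g x) + (∑pick xs (λ z zs → g z x zs) + ∑pick xs (λ z zs → ∑pick zs (λ z′ zs′ → g z′ z (x ∷ zs′))))
      ≈⟨ solve 3 (λ a b c → a :+ (b :+ c) := b :+ (a :+ c)) refl _ _ _ ⟩
    ∑pick xs (λ z zs → g z x zs) + (∑pick xs (g x) + ∑pick xs (λ z zs → ∑pick zs (λ z′ zs′ → g z′ z (x ∷ zs′))))
      ≈⟨ +-congˡ (∑pick-+ xs _ _) ⟨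
    ∑pick xs (λ z zs → g z x zs) + ∑pick xs (λ z zs → g x z zs + ∑pick zs (λ z′ zs′ → g z′ z (x ∷ zs′))) ∎

  ∑pick-↭ : {xs ys : List A} {g : A → List A → K} →
    (∀ {z zs zs′} → zs ↭ zs′ → g z zs ≈ g z zs′) → xs ↭ ys → ∑pick xs g ≈ ∑pick ys g
  ∑pick-↭ r ↭.refl         = refl
  ∑pick-↭ r (↭.prep x p)   = +-cong (r p) (∑pick-↭ (r ∘ ↭.prep x) p)
  ∑pick-↭ {g = g} r (↭.swap {xs} {ys} x y p) = begin
    g x (y ∷ xs) + (g y (x ∷ xs) + ∑pick xs (λ z zs → g z (x ∷ y ∷ zs)))
      ≈⟨ +-cong (r (↭.prep y p)) (+-cong (r (↭.prep x p))
           (trans (∑pick-↭ (r ∘ ↭.prep x ∘ ↭.prep y) p)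
             (∑pick-cong ys λ {z} {zs} _ → r {z} (↭.swap x y (↭.refl {xs = zs}))))) ⟩
    g x (y ∷ ys) + (g y (x ∷ ys) + ∑pick ys (λ z zs → g z (y ∷ x ∷ zs)))
      ≈⟨ solve 3 (λ a b c → a :+ (b :+ c) := b :+ (a :+ c)) refl _ _ _ ⟩
    g y (x ∷ ys) + (g x (y ∷ ys) + ∑pick ys (λ z zs → g z (y ∷ x ∷ zs))) ∎
  ∑pick-↭ r (↭.trans p p′) = trans (∑pick-↭ r p) (∑pick-↭ r p′)

  -- The sum over all bijections from xs to ys, and 0 if the lengths differ. The edges are listed in
  -- the order of xs, so results that move rows ask for a `Symmetric` f.
  ∑match : List A → List B → (List (A × B) → K) → K
  ∑match []       []      f = f []
  ∑match []       (_ ∷ _) f = 0#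
  ∑match (x ∷ xs) ys      f = ∑pick ys (λ y ys′ → ∑match xs ys′ (λ M → f ((x , y) ∷ M)))

  ∑match-cong : ∀ {P : A → Set} {Q : B → Set} {xs ys f g} → All P xs → All Q ys →
    (∀ {M} → All (λ e → P (proj₁ e) × Q (proj₂ e)) M → f M ≈ g M) → ∑match xs ys f ≈ ∑match xs ys g
  ∑match-cong {ys = []}    []       qs p = p []
  ∑match-cong {ys = _ ∷ _} []       qs p = refl
  ∑match-cong {ys = ys} (px ∷ ps) qs p = ∑pick-cong ys λ k →
    ∑match-cong ps (proj₂ (Pick-All k qs)) (λ all → p ((px , proj₁ (Pick-All k qs)) ∷ all))

  ∑match-cong′ : ∀ (xs : List A) (ys : List B) {f g} → (∀ M → f M ≈ g M) → ∑match xs ys f ≈ ∑match xs ys g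
  ∑match-cong′ []       []      p = p []
  ∑match-cong′ []       (_ ∷ _) p = refl
  ∑match-cong′ (x ∷ xs) ys      p = ∑pick-cong ys λ {_} {zs} _ → ∑match-cong′ xs zs (λ M → p _)

  ∑match-* : ∀ (xs : List A) (ys : List B) k f → ∑match xs ys (λ M → k * f M) ≈ k * ∑match xs ys f
  ∑match-* []       []      k f = refl
  ∑match-* []       (_ ∷ _) k f = sym (zeroʳ k)
  ∑match-* (x ∷ xs) ys      k f =
    trans (∑pick-cong ys λ {_} {zs} _ → ∑match-* xs zs k _) (∑pick-* ys k _)

  -- Every matching uses each column exactly once, so a product of column weights is the same for
  -- all of them. For lists of different lengths both sides vanish.
  ∑match-Πcol : ∀ (h : B → K) (xs : List A) ys f →
    ∑match xs ys (λ M → Π (h ∘ proj₂) M * f M) ≈ Π h ys * ∑match xs ys f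
  ∑match-Πcol h []       []      f = refl
  ∑match-Πcol h []       (_ ∷ _) f = sym (zeroʳ _)
  ∑match-Πcol h (x ∷ xs) ys      f = trans (∑pick-cong ys λ {y} {zs} k → begin
    ∑match xs zs (λ M → h y * Π (h ∘ proj₂) M * f ((x , y) ∷ M))
      ≈⟨ ∑match-cong′ xs zs (λ M → solve 3 (λ a b c → a :* b :* c := b :* (a :* c)) refl _ _ _) ⟩
    ∑match xs zs (λ M → Π (h ∘ proj₂) M * (h y * f ((x , y) ∷ M)))
      ≈⟨ ∑match-Πcol h xs zs _ ⟩
    Π h zs * ∑match xs zs (λ M → h y * f ((x , y) ∷ M))
      ≈⟨ *-congˡ (∑match-* xs zs _ _) ⟩
    Π h zs * (h y * ∑match xs zs (λ M → f ((x , y) ∷ M)))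
      ≈⟨ solve 3 (λ a b c → a :* (b :* c) := b :* a :* c) refl _ _ _ ⟩
    h y * Π h zs * ∑match xs zs (λ M → f ((x , y) ∷ M))
      ≈⟨ *-congʳ (Pick-Π k) ⟨
    Π h ys * ∑match xs zs (λ M → f ((x , y) ∷ M)) ∎) (∑pick-* ys _ _)
    where
    Pick-Π : ∀ {ys z zs} → Pick ys z zs → Π h ys ≈ h z * Π h zs
    Pick-Π here = refl
    Pick-Π (there k) = trans (*-congˡ (Pick-Π k))
      (solve 3 (λ a b c → a :* (b :* c) := b :* (a :* c)) refl _ _ _)

  ∑match-Πrow : ∀ (h : A → K) (xs : List A) (ys : List B) f →
    ∑match xs ys (λ M → Π (h ∘ proj₁) M * f M) ≈ Π h xs * ∑match xs ys f
  ∑match-Πrow h []       []      f = refl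
  ∑match-Πrow h []       (_ ∷ _) f = sym (zeroʳ _)
  ∑match-Πrow h (x ∷ xs) ys      f = trans (∑pick-cong ys λ {y} {zs} _ → begin
    ∑match xs zs (λ M → h x * Π (h ∘ proj₁) M * f ((x , y) ∷ M))
      ≈⟨ ∑match-cong′ xs zs (λ M → *-assoc _ _ _) ⟩
    ∑match xs zs (λ M → h x * (Π (h ∘ proj₁) M * f ((x , y) ∷ M)))
      ≈⟨ ∑match-* xs zs _ _ ⟩
    h x * ∑match xs zs (λ M → Π (h ∘ proj₁) M * f ((x , y) ∷ M))
      ≈⟨ *-congˡ (∑match-Πrow h xs zs _) ⟩
    h x * (Π h xs * ∑match xs zs (λ M → f ((x , y) ∷ M)))
      ≈⟨ *-assoc _ _ _ ⟨
    h x * Π h xs * ∑match xs zs (λ M → f ((x , y) ∷ M)) ∎) (∑pick-* ys _ _)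

  ∑match-↭ʳ : ∀ (xs : List A) {ys ys′ : List B} {f} → ys ↭ ys′ → ∑match xs ys f ≈ ∑match xs ys′ f
  ∑match-↭ʳ []       {[]}    {[]}    p = refl
  ∑match-↭ʳ []       {[]}    {_ ∷ _} p = ⊥-elim (¬x∷xs↭[] (↭-sym p))
  ∑match-↭ʳ []       {_ ∷ _} {[]}    p = ⊥-elim (¬x∷xs↭[] p)
  ∑match-↭ʳ []       {_ ∷ _} {_ ∷ _} p = refl
  ∑match-↭ʳ (x ∷ xs) p = ∑pick-↭ (∑match-↭ʳ xs) p

  Symmetric : (List A → K) → Set _
  Symmetric f = ∀ {M M′} → M ↭ M′ → f M ≈ f M′

  ∑match-↭ˡ : ∀ {xs xs′ : List A} (ys : List B) {f} → Symmetric f → xs ↭ xs′ →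
              ∑match xs ys f ≈ ∑match xs′ ys f
  ∑match-↭ˡ ys s ↭.refl         = refl
  ∑match-↭ˡ ys s (↭.prep x p)   = ∑pick-cong ys λ {_} {zs} _ → ∑match-↭ˡ zs (s ∘ ↭.prep _) p
  ∑match-↭ˡ {xs = x ∷ x′ ∷ xs} {xs′ = _ ∷ _ ∷ xs′} ys {f} s (↭.swap _ _ p) = begin
    ∑pick ys (λ y ys′ → ∑pick ys′ (λ y′ zs → ∑match xs zs (λ M → f ((x , y) ∷ (x′ , y′) ∷ M))))
      ≈⟨ ∑pick-swap ys _ ⟩
    ∑pick ys (λ y′ ys′ → ∑pick ys′ (λ y zs → ∑match xs zs (λ M → f ((x , y) ∷ (x′ , y′) ∷ M))))
      ≈⟨ ∑pick-cong ys (λ {y′} {ys′} _ → ∑pick-cong ys′ λ {y} {zs} _ → trans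
           (∑match-↭ˡ zs (s ∘ ↭.prep _ ∘ ↭.prep _) p)
           (∑match-cong′ xs′ zs λ M → s (↭.swap _ _ (↭.refl {xs = M})))) ⟩
    ∑pick ys (λ y′ ys′ → ∑pick ys′ (λ y zs → ∑match xs′ zs (λ M → f ((x′ , y′) ∷ (x , y) ∷ M)))) ∎
  ∑match-↭ˡ ys s (↭.trans p p′) = trans (∑match-↭ˡ ys s p) (∑match-↭ˡ ys s p′)

  -- Laplace expansion of a permanent along a column. The edge in that column has to be moved to the
  -- front of the matching, whence the symmetry of f.
  ∑match-column : ∀ (xs : List A) (y : B) (ys : List B) {f} → Symmetric f →
    ∑match xs (y ∷ ys) f ≈ ∑pick xs (λ x xs′ → ∑match xs′ ys (λ M → f ((x , y) ∷ M)))
  ∑match-column []       y ys s = refl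
  ∑match-column (x ∷ xs) y ys {f} s = +-congˡ (begin
    ∑pick ys (λ y′ ys′ → ∑match xs (y ∷ ys′) (λ M → f ((x , y′) ∷ M)))
      ≈⟨ ∑pick-cong ys (λ {_} {zs} _ → ∑match-column xs y zs (s ∘ ↭.prep _)) ⟩
    ∑pick ys (λ y′ ys′ → ∑pick xs (λ x′ xs′ → ∑match xs′ ys′ (λ M → f ((x , y′) ∷ (x′ , y) ∷ M))))
      ≈⟨ ∑pick-comm ys xs _ ⟩
    ∑pick xs (λ x′ xs′ → ∑pick ys (λ y′ ys′ → ∑match xs′ ys′ (λ M → f ((x , y′) ∷ (x′ , y) ∷ M))))
      ≈⟨ ∑pick-cong xs (λ {_} {xs′} _ → ∑pick-cong ys λ {_} {zs} _ →
           ∑match-cong′ xs′ zs λ M → s (↭.swap _ _ (↭.refl {xs = M}))) ⟩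
    ∑pick xs (λ x′ xs′ → ∑match (x ∷ xs′) ys (λ M → f ((x′ , y) ∷ M))) ∎)

-- Pending rows and columns

choose : ∀ {a p} {A : Set a} {P : Set p} → Dec P → A → A → A
choose (yes _) x z = x
choose (no  _) x z = z

choose-yes : ∀ {a p} {A : Set a} {P : Set p} {x z : A} (d : Dec P) → P → choose d x z ≡ x
choose-yes (yes _) p = ≡.refl
choose-yes (no ¬p) p = ⊥-elim (¬p p)

choose-no : ∀ {a p} {A : Set a} {P : Set p} {x z : A} (d : Dec P) → ¬ P → choose d x z ≡ z
choose-no (yes p) ¬p = ⊥-elim (¬p p)
choose-no (no _)  ¬p = ≡.refl

choose-⇔ : ∀ {a p r} {A : Set a} {P : Set p} {Q : Set r} {x z : A} (d : Dec P) (d′ : Dec Q) →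
           (P → Q) → (Q → P) → choose d x z ≡ choose d′ x z
choose-⇔ (yes p) d′ f g = ≡.sym (choose-yes d′ (f p))
choose-⇔ (no ¬p) d′ f g = ≡.sym (choose-no d′ (¬p ∘ g))

upFrom : ℕ → ℕ → List ℕ
upFrom t zero    = []
upFrom t (suc n) = t ∷ upFrom (suc t) n

upFrom-≥ : ∀ t n → All (t ≤_) (upFrom t n)
upFrom-≥ t zero    = []
upFrom-≥ t (suc n) = ℕ.≤-refl ∷ All.map ℕ.<⇒≤ (upFrom-≥ (suc t) n)

-- new and old hold the pending elements inside and before the current segment, old being
-- listed youngest first.
record Pending (T : ℕ) (new old : List ℕ) : Set where
  field
    new<       : All (_< T) new
    old<       : All (_< T) old
    decreasing : AllPairs _>_ old
    separated  : All (λ k → All (_< k) old) new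

Pending-pick : ∀ {t new old old′ j} → Pick old j old′ → Pending t new old → Pending t new old′
Pending-pick k P = record
  { new< = new< ; old< = proj₂ (Pick-All k old<) ; decreasing = Pick-AllPairs k decreasing
  ; separated = All.map (λ p → proj₂ (Pick-All k p)) separated }
  where open Pending P

Pending-suc : ∀ {t new old} → Pending t new old → Pending (suc t) new old
Pending-suc P = record
  { new< = All.map ℕ.m<n⇒m<1+n new< ; old< = All.map ℕ.m<n⇒m<1+n old<
  ; decreasing = decreasing ; separated = separated }
  where open Pending P

Pending-all : ∀ {t new old} → Pending t new old → All (_< t) (new ++ old)
Pending-all P = All.++⁺ new< old<
  where open Pending P

≢-future : ∀ t n {p} → All (_< t) p → All (_≢ t) (upFrom (suc t) n ++ p)
≢-future t n ps = All.++⁺ (All.map (λ t<i i≡t → ℕ.<-irrefl (≡.sym i≡t) t<i) (upFrom-≥ (suc t) n))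
                          (All.map ℕ.<⇒≢ ps)

segmentℕ : ∀ {k} → Vec ℕ k → ℕ → ℕ
segmentℕ []       i = 0
segmentℕ (n ∷ ns) i = choose (i <? n) 0 (suc (segmentℕ ns (i ∸ n)))

Edge : Set
Edge = ℕ × ℕ

-- Weights of matchings, and the reading of one row or one column

module Transfer {c ℓ : Level} (R : CommutativeRing c ℓ) (y q : CommutativeRing.Carrier R)
                (Forbidden : ℕ → ℕ → Set) (forbidden? : ∀ i j → Dec (Forbidden i j)) where
  open CommutativeRing R hiding (zero) renaming (Carrier to K)
  open Operators R y q using ([_]; δ)
  open Sums R
  open import Algebra.Properties.Semiring.Exp semiring using (_^_)
  open import Algebra.Solver.Ring.NaturalCoefficients.Default commutativeSemiring
    using (solve; _:=_; _:+_; _:*_; con)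
  open import Relation.Binary.Reasoning.Setoid setoid

  edge : Edge → K
  edge (i , j) = choose (forbidden? i j) 0# (choose (i ≤? j) y 1#)

  -- Rows below r and columns below c are pending: they may not be matched with each other.
  live : ℕ → ℕ → Edge → K
  live r c (i , j) = choose ((i <? r) ×-dec (j <? c)) 0# (edge (i , j))

  -- The two kinds of crossings in `cr`. In `χ e e′` the edge e belongs to the outer summation index
  -- of `cr`, which is why `up` takes its arguments in the opposite order. `χ₂` joins both orders
  -- into one factor per unordered pair.
  up low χ χ₂ : Edge → Edge → K
  up  (i , j) (i′ , j′) = choose ((i <? i′) ×-dec ((i′ ≤? j) ×-dec (j <? j′))) q 1#
  low (i , j) (i′ , j′) = choose ((i <? i′) ×-dec ((j′ <? i) ×-dec (j <? j′))) q 1#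
  χ  e e′ = up e′ e * low e e′
  χ₂ e e′ = χ e e′ * χ e′ e

  W : ℕ → ℕ → List Edge → K
  W r c []      = 1#
  W r c (e ∷ M) = live r c e * Π (χ₂ e) M * W r c M

  W-symmetric : ∀ r c → Symmetric (W r c)
  W-symmetric r c ↭.refl          = refl
  W-symmetric r c (↭.prep e p)    = *-cong (*-congˡ (Π-↭ (χ₂ e) p)) (W-symmetric r c p)
  W-symmetric r c (↭.swap {M} {M′} e e′ p) = begin
    live r c e * (χ₂ e e′ * Π (χ₂ e) M) * (live r c e′ * Π (χ₂ e′) M * W r c M)
      ≈⟨ *-cong (*-congˡ (*-cong (*-comm _ _) (Π-↭ (χ₂ e) p)))
                (*-cong (*-congˡ (Π-↭ (χ₂ e′) p)) (W-symmetric r c p)) ⟩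
    live r c e * (χ₂ e′ e * Π (χ₂ e) M′) * (live r c e′ * Π (χ₂ e′) M′ * W r c M′)
      ≈⟨ solve 6 (λ a b x d f g → a :* (b :* x) :* (d :* f :* g) := d :* (b :* f) :* (a :* x :* g)) refl
           (live r c e) (χ₂ e′ e) _ (live r c e′) _ _ ⟩
    live r c e′ * (χ₂ e′ e * Π (χ₂ e′) M′) * (live r c e * Π (χ₂ e) M′ * W r c M′) ∎
  W-symmetric r c (↭.trans p p′)  = trans (W-symmetric r c p) (W-symmetric r c p′)

  W-cong : ∀ {r c r′ c′ M} → All (λ e → live r c e ≈ live r′ c′ e) M → W r c M ≈ W r′ c′ M
  W-cong []       = refl
  W-cong (p ∷ ps) = *-cong (*-congʳ p) (W-cong ps)

  -- `W r c M` contains the factor `live r c e′` of every edge e′ of M, so the two products need to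
  -- agree only on edges that this factor does not kill.
  W-Π : ∀ {r c} e (h : Edge → K) {M} → All (λ e′ → χ₂ e e′ * live r c e′ ≈ h e′ * live r c e′) M →
        Π (χ₂ e) M * W r c M ≈ Π h M * W r c M
  W-Π e h [] = refl
  W-Π {r} {c} e h {e′ ∷ M} (p ∷ ps) = begin
    χ₂ e e′ * Π (χ₂ e) M * (live r c e′ * Π (χ₂ e′) M * W r c M)
      ≈⟨ rearrange ⟩
    χ₂ e e′ * live r c e′ * Π (χ₂ e′) M * (Π (χ₂ e) M * W r c M)
      ≈⟨ *-cong (*-congʳ p) (W-Π e h ps) ⟩
    h e′ * live r c e′ * Π (χ₂ e′) M * (Π h M * W r c M)
      ≈⟨ rearrange ⟨
    h e′ * Π h M * (live r c e′ * Π (χ₂ e′) M * W r c M) ∎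
    where
    rearrange : ∀ {a b c d e} → a * b * (c * d * e) ≈ a * c * d * (b * e)
    rearrange = solve 5 (λ a b c d e → a :* b :* (c :* d :* e) := a :* c :* d :* (b :* e)) refl _ _ _ _ _

  Z : ℕ → ℕ → List ℕ → List ℕ → K
  Z r c xs ys = ∑match xs ys (W r c)

  -- The crossing charged when j is met while the younger j′ is pending; T bounds the elements
  -- already read.
  above : ℕ → ℕ → ℕ → K
  above T j j′ = choose ((j <? j′) ×-dec (j′ <? T)) q 1#

  live-0 : ∀ r c {i j} → i < r → j < c → live r c (i , j) ≈ 0#
  live-0 r c i<r j<c = reflexive (choose-yes ((_ <? r) ×-dec (_ <? c)) (i<r , j<c))

  live-1 : ∀ r c {i j} → ¬ (i < r × j < c) → live r c (i , j) ≈ edge (i , j)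
  live-1 r c = reflexive ∘ choose-no ((_ <? r) ×-dec (_ <? c))

  live-row : ∀ t {i j} → i ≢ t → live t t (i , j) ≈ live (suc t) t (i , j)
  live-row t {i} {j} i≢t = reflexive (choose-⇔ ((i <? t) ×-dec (j <? t)) ((i <? suc t) ×-dec (j <? t))
    (λ (p , r) → ℕ.m<n⇒m<1+n p , r) (λ (p , r) → ℕ.≤∧≢⇒< (ℕ.≤-pred p) i≢t , r))

  live-col : ∀ t {i j} → j ≢ t → live (suc t) t (i , j) ≈ live (suc t) (suc t) (i , j)
  live-col t {i} {j} j≢t = reflexive (choose-⇔ ((i <? suc t) ×-dec (j <? t)) ((i <? suc t) ×-dec (j <? suc t))
    (λ (p , r) → p , ℕ.m<n⇒m<1+n r) (λ (p , r) → p , ℕ.≤∧≢⇒< (ℕ.≤-pred r) j≢t))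

  private
    unless-live : ∀ r c {i j a b} → (¬ (i < r × j < c) → a ≈ b) → a * live r c (i , j) ≈ b * live r c (i , j)
    unless-live r c {i} {j} {a} {b} f = go ((i <? r) ×-dec (j <? c))
      where
      go : Dec (i < r × j < c) → a * live r c (i , j) ≈ b * live r c (i , j)
      go (yes (p , p′)) = trans (*-congˡ (live-0 r c p p′))
        (trans (zeroʳ a) (sym (trans (*-congˡ (live-0 r c p p′)) (zeroʳ b))))
      go (no ¬p)        = *-congʳ (f ¬p)

  -- If j′ < t, the other edge survives only for i′ > t, and then it crosses exactly when j < j′. If
  -- j′ ≥ t, it cannot cross an edge from row t to an earlier column. Thus the factor depends on j′
  -- alone and can be taken out of the matching sum.
  χ₂-row : ∀ t j i′ j′ → j < t → i′ ≢ t →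
    χ₂ (t , j) (i′ , j′) * live t t (i′ , j′) ≈ above t j j′ * live t t (i′ , j′)
  χ₂-row t j i′ j′ j<t i′≢t = unless-live t t λ ¬p → begin
    χ₂ (t , j) (i′ , j′)
      ≈⟨ *-cong
          (*-cong (reflexive (choose-no ((i′ <? t) ×-dec ((t ≤? j′) ×-dec (j′ <? j)))
                    λ (_ , t≤j′ , j′<j) → ℕ.<-irrefl ≡.refl (ℕ.<-trans j<t (ℕ.≤-<-trans t≤j′ j′<j))))
                  (reflexive (choose-⇔ ((t <? i′) ×-dec ((j′ <? t) ×-dec (j <? j′))) ((j <? j′) ×-dec (j′ <? t))
                    (λ (_ , p , r) → r , p)
                    (λ (r , p) → ℕ.≤∧≢⇒< (ℕ.≮⇒≥ λ i′<t → ¬p (i′<t , p)) (i′≢t ∘ ≡.sym) , p , r))))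
          (*-cong (reflexive (choose-no ((t <? i′) ×-dec ((i′ ≤? j) ×-dec (j <? j′)))
                    λ (t<i′ , i′≤j , _) → ℕ.<-irrefl ≡.refl (ℕ.<-trans j<t (ℕ.<-≤-trans t<i′ i′≤j))))
                  (reflexive (choose-no ((i′ <? t) ×-dec ((j <? i′) ×-dec (j′ <? j)))
                    λ (i′<t , _ , j′<j) → ¬p (i′<t , ℕ.<-trans j′<j j<t)))) ⟩
    1# * above t j j′ * (1# * 1#)
      ≈⟨ solve 1 (λ a → con 1 :* a :* (con 1 :* con 1) := a) refl _ ⟩
    above t j j′ ∎

  -- The analogue for upper crossings. The bound is `suc t`, as row t is already pending when column
  -- t is read.
  χ₂-col : ∀ t i i′ j′ → i < suc t → j′ ≢ t →
    χ₂ (i , t) (i′ , j′) * live (suc t) t (i′ , j′) ≈ above (suc t) i i′ * live (suc t) t (i′ , j′)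
  χ₂-col t i i′ j′ i≤t j′≢t = unless-live (suc t) t λ ¬p → begin
    χ₂ (i , t) (i′ , j′)
      ≈⟨ *-cong
          (*-cong (reflexive (choose-no ((i′ <? i) ×-dec ((i ≤? j′) ×-dec (j′ <? t)))
                    λ (i′<i , _ , j′<t) → ¬p (ℕ.<-trans i′<i i≤t , j′<t)))
                  (reflexive (choose-no ((i <? i′) ×-dec ((j′ <? i) ×-dec (t <? j′)))
                    λ (_ , j′<i , t<j′) → ℕ.<-irrefl ≡.refl (ℕ.<-≤-trans (ℕ.<-trans t<j′ j′<i) (ℕ.≤-pred i≤t)))))
          (*-cong (reflexive (choose-⇔ ((i <? i′) ×-dec ((i′ ≤? t) ×-dec (t <? j′))) ((i <? i′) ×-dec (i′ <? suc t))
                    (λ (p , r , _) → p , ℕ.s≤s r)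
                    (λ (p , r) → p , ℕ.≤-pred r , ℕ.≤∧≢⇒< (ℕ.≮⇒≥ λ j′<t → ¬p (r , j′<t)) (j′≢t ∘ ≡.sym))))
                  (reflexive (choose-no ((i′ <? i) ×-dec ((t <? i′) ×-dec (j′ <? t)))
                    λ (i′<i , t<i′ , _) → ℕ.<-irrefl ≡.refl (ℕ.<-≤-trans (ℕ.<-trans t<i′ i′<i) (ℕ.≤-pred i≤t))))) ⟩
    1# * 1# * (above (suc t) i i′ * 1#)
      ≈⟨ solve 1 (λ a → con 1 :* con 1 :* (a :* con 1) := a) refl _ ⟩
    above (suc t) i i′ ∎

  Π-above-1 : ∀ T j {xs} → All (λ k → ¬ (j < k × k < T)) xs → Π (above T j) xs ≈ 1#
  Π-above-1 T j {xs} p = trans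
    (Π-cong (λ {k} ¬p → reflexive (choose-no ((j <? k) ×-dec (k <? T)) ¬p)) p) (Π-1 xs)

  Π-above-q : ∀ T j {xs} → All (λ k → j < k × k < T) xs → Π (above T j) xs ≈ q ^ length xs
  Π-above-q T j {[]}     []       = refl
  Π-above-q T j {k ∷ xs} (p ∷ ps) =
    *-cong (reflexive (choose-yes ((j <? k) ×-dec (k <? T)) p)) (Π-above-q T j ps)

  -- The list is youngest first, so its entry at position k has k younger ones and contributes q^k.
  ∑pick-above : ∀ T {xs} → AllPairs _>_ xs → All (_< T) xs →
    ∑pick xs (λ j xs′ → Π (above T j) xs′) ≈ [ length xs ]
  ∑pick-above T []       []       = refl
  ∑pick-above T {k ∷ xs} (d ∷ ds) (k<T ∷ ps) = +-cong
    (Π-above-1 T k (All.map (λ z<k (k<z , _) → ℕ.<-asym z<k k<z) d))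
    (begin
      ∑pick xs (λ j xs′ → above T j k * Π (above T j) xs′)
        ≈⟨ ∑pick-cong xs (λ {j} π → *-congʳ
             (reflexive (choose-yes ((j <? k) ×-dec (k <? T)) (proj₁ (Pick-All π d) , k<T)))) ⟩
      ∑pick xs (λ j xs′ → q * Π (above T j) xs′)
        ≈⟨ ∑pick-* xs q _ ⟩
      q * ∑pick xs (λ j xs′ → Π (above T j) xs′)
        ≈⟨ *-congˡ (∑pick-above T ds ps) ⟩
      q * [ length xs ] ∎)

  -- The weight w excludes the new elements as partners, but each of them is younger than every old
  -- one and so adds a factor q to every meeting.
  ∑pick-pending : ∀ {T new old} → Pending T new old → (w : ℕ → K) (ω : K) →
    All (λ j → w j ≈ 0#) new → All (λ j → w j ≈ ω) old →
    (V : List ℕ → K) (v : K) → (∀ {j old′} → Pick old j old′ → V (new ++ old′) ≈ v) →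
    ∑pick (new ++ old) (λ j p → w j * (Π (above T j) p * V p)) ≈ q ^ length new * (ω * [ length old ]) * v
  ∑pick-pending {T} {new} {old} P w ω w-new w-old V v p = begin
    ∑pick (new ++ old) _
      ≈⟨ ∑pick-++ new old _ ⟩
    ∑pick new _ + ∑pick old _
      ≈⟨ +-cong
          (trans (∑pick-cong new λ k → trans (*-congʳ (proj₁ (Pick-All k w-new))) (zeroˡ _)) (∑pick-0 new))
          (∑pick-cong old λ {j} {old′} k → begin
            w j * (Π (above T j) (new ++ old′) * V (new ++ old′))
              ≈⟨ *-cong (proj₁ (Pick-All k w-old)) (*-cong (Π-++ (above T j) new) (p k)) ⟩
            ω * (Π (above T j) new * Π (above T j) old′ * v)
              ≈⟨ *-congˡ (*-congʳ (*-congʳ (Π-above-q T j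
                   (All.zipWith (λ (l , k<T) → proj₁ (Pick-All k l) , k<T) (separated , new<))))) ⟩
            ω * (q ^ length new * Π (above T j) old′ * v)
              ≈⟨ solve 4 (λ a b c d → a :* (b :* c :* d) := a :* b :* d :* c) refl ω (q ^ length new) _ v ⟩
            ω * q ^ length new * v * Π (above T j) old′ ∎) ⟩
    0# + ∑pick old (λ j old′ → ω * q ^ length new * v * Π (above T j) old′)
      ≈⟨ trans (+-identityˡ _) (∑pick-* old _ _) ⟩
    ω * q ^ length new * v * ∑pick old (λ j old′ → Π (above T j) old′)
      ≈⟨ *-congˡ (∑pick-above T decreasing old<) ⟩
    ω * q ^ length new * v * [ length old ]
      ≈⟨ solve 4 (λ a b c d → a :* b :* c :* d := b :* (a :* d) :* c) refl ω (q ^ length new) v _ ⟩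
    q ^ length new * (ω * [ length old ]) * v ∎
    where open Pending P

  ∑match-0 : ∀ xs ys {f : List Edge → K} → (∀ M → f M ≈ 0#) → ∑match xs ys f ≈ 0#
  ∑match-0 xs ys {f} p = begin
    ∑match xs ys f               ≈⟨ ∑match-cong′ xs ys (λ M → trans (p M) (sym (zeroˡ 0#))) ⟩
    ∑match xs ys (λ _ → 0# * 0#) ≈⟨ ∑match-* xs ys 0# _ ⟩
    0# * ∑match xs ys (λ _ → 0#) ≈⟨ zeroˡ _ ⟩
    0# ∎

  W-dead : ∀ r c {i j} → i < r → j < c → ∀ M → W r c ((i , j) ∷ M) ≈ 0#
  W-dead r c p p′ M = trans (*-congʳ (trans (*-congʳ (live-0 r c p p′)) (zeroˡ _))) (zeroˡ _)

  private
    trivial : ∀ {A : Set} (xs : List A) → All (λ _ → ⊤) xs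
    trivial = All.universal _

  -- Expansion along row t. Choosing a pending column closes an edge. The remaining choices are what
  -- is left once row t is declared pending, since raising the first threshold kills precisely its
  -- edges to pending columns. The list fc may contain t, so a fixed point is left to the column
  -- step. The value v is the same for all choices because only the number of pending elements
  -- matters.
  row-step : ∀ t xs fc {new old} → Pending t new old →
    All (_≢ t) xs → All (t ≤_) fc →
    All (λ j → edge (t , j) ≈ 0#) new → All (λ j → edge (t , j) ≈ 1#) old →
    ∀ v → (∀ {j old′} → Pick old j old′ → Z (suc t) t xs (fc ++ (new ++ old′)) ≈ v) →
    Z t t (t ∷ xs) (fc ++ (new ++ old)) ≈
    Z (suc t) t (t ∷ xs) (fc ++ (new ++ old)) + q ^ length new * [ length old ] * v
  row-step t xs fc {new} {old} P xs≢t t≤fc e-new e-old v hyp = begin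
    Z t t (t ∷ xs) (fc ++ p)
      ≈⟨ ∑pick-++ fc p _ ⟩
    ∑pick fc (λ z zs → ∑match xs (zs ++ p) (λ M → W t t ((t , z) ∷ M))) +
    ∑pick p (λ j p′ → ∑match xs (fc ++ p′) (λ M → W t t ((t , j) ∷ M)))
      ≈⟨ +-cong (∑pick-cong fc λ {z} {zs} k → future (proj₁ (Pick-All k t≤fc)) zs)
                (∑pick-cong p λ {j} {p′} k → close (proj₁ (Pick-All k p<t)) p′) ⟩
    ∑pick fc (λ z zs → ∑match xs (zs ++ p) (λ M → W (suc t) t ((t , z) ∷ M))) +
    ∑pick p (λ j p′ → edge (t , j) * (Π (above t j) p′ * Z (suc t) t xs (fc ++ p′)))
      ≈⟨ +-cong (sym rest) (trans
           (∑pick-pending P (λ j → edge (t , j)) 1# e-new e-old (λ p′ → Z (suc t) t xs (fc ++ p′)) v hyp)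
           (*-congʳ (*-congˡ (*-identityˡ _)))) ⟩
    Z (suc t) t (t ∷ xs) (fc ++ p) + q ^ length new * [ length old ] * v ∎
    where
    open Pending P
    p = new ++ old
    p<t : All (_< t) p
    p<t = All.++⁺ new< old<

    future : ∀ {z} → t ≤ z → ∀ zs → ∑match xs (zs ++ p) (λ M → W t t ((t , z) ∷ M)) ≈
             ∑match xs (zs ++ p) (λ M → W (suc t) t ((t , z) ∷ M))
    future t≤z zs = ∑match-cong xs≢t (trivial (zs ++ p)) λ all →
      W-cong (trans (live-1 t t (λ (r , _) → ℕ.<-irrefl ≡.refl r))
                      (sym (live-1 (suc t) t (λ (_ , r) → ℕ.<⇒≱ r t≤z)))
              ∷ All.map (live-row t ∘ proj₁) all)

    close : ∀ {j} → j < t → ∀ p′ → ∑match xs (fc ++ p′) (λ M → W t t ((t , j) ∷ M)) ≈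
            edge (t , j) * (Π (above t j) p′ * Z (suc t) t xs (fc ++ p′))
    close {j} j<t p′ = begin
      ∑match xs (fc ++ p′) (λ M → live t t (t , j) * Π (χ₂ (t , j)) M * W t t M)
        ≈⟨ ∑match-cong xs≢t (trivial (fc ++ p′)) (λ {M} all → trans (*-assoc _ _ _)
             (*-cong (live-1 t t (λ (r , _) → ℕ.<-irrefl ≡.refl r))
               (trans (W-Π (t , j) (above t j ∘ proj₂) (All.map (χ₂-row t j _ _ j<t ∘ proj₁) all))
                        (*-congˡ (W-cong (All.map (live-row t ∘ proj₁) all)))))) ⟩
      ∑match xs (fc ++ p′) (λ M → edge (t , j) * (Π (above t j ∘ proj₂) M * W (suc t) t M))
        ≈⟨ ∑match-* xs (fc ++ p′) _ _ ⟩
      edge (t , j) * ∑match xs (fc ++ p′) (λ M → Π (above t j ∘ proj₂) M * W (suc t) t M)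
        ≈⟨ *-congˡ (∑match-Πcol (above t j) xs (fc ++ p′) _) ⟩
      edge (t , j) * (Π (above t j) (fc ++ p′) * Z (suc t) t xs (fc ++ p′))
        ≈⟨ *-congˡ (*-congʳ (trans (Π-++ (above t j) fc) (trans
             (*-congʳ (Π-above-1 t j (All.map (λ t≤k (_ , k<t) → ℕ.<⇒≱ k<t t≤k) t≤fc))) (*-identityˡ _)))) ⟩
      edge (t , j) * (Π (above t j) p′ * Z (suc t) t xs (fc ++ p′)) ∎

    rest : Z (suc t) t (t ∷ xs) (fc ++ p) ≈
           ∑pick fc (λ z zs → ∑match xs (zs ++ p) (λ M → W (suc t) t ((t , z) ∷ M)))
    rest = trans (∑pick-++ fc p _) (trans (+-congˡ (trans
      (∑pick-cong p λ {j} {p′} k → ∑match-0 xs (fc ++ p′) (W-dead (suc t) t ℕ.≤-refl (proj₁ (Pick-All k p<t))))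
      (∑pick-0 p))) (+-identityʳ _))

  -- Expansion along column t. Row t may be among the pending rows here, so a fixed point closes in
  -- this step with weight y.
  column-step : ∀ t fr ys {new old} → Pending (suc t) new old →
    All (_≢ t) ys → All (suc t ≤_) fr →
    All (λ i → edge (i , t) ≈ 0#) new → All (λ i → edge (i , t) ≈ y) old →
    ∀ v → (∀ {i old′} → Pick old i old′ → Z (suc t) (suc t) (fr ++ (new ++ old′)) ys ≈ v) →
    Z (suc t) t (fr ++ (new ++ old)) (t ∷ ys) ≈
    Z (suc t) (suc t) (fr ++ (new ++ old)) (t ∷ ys) + q ^ length new * (y * [ length old ]) * v
  column-step t fr ys {new} {old} P ys≢t t<fr e-new e-old v hyp = begin
    Z (suc t) t (fr ++ p) (t ∷ ys)
      ≈⟨ ∑match-column (fr ++ p) t ys (W-symmetric (suc t) t) ⟩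
    ∑pick (fr ++ p) _
      ≈⟨ ∑pick-++ fr p _ ⟩
    ∑pick fr (λ z zs → ∑match (zs ++ p) ys (λ M → W (suc t) t ((z , t) ∷ M))) +
    ∑pick p (λ i p′ → ∑match (fr ++ p′) ys (λ M → W (suc t) t ((i , t) ∷ M)))
      ≈⟨ +-cong (∑pick-cong fr λ {z} {zs} k → future (proj₁ (Pick-All k t<fr)) zs)
                (∑pick-cong p λ {i} {p′} k → close (proj₁ (Pick-All k p≤t)) p′) ⟩
    ∑pick fr (λ z zs → ∑match (zs ++ p) ys (λ M → W (suc t) (suc t) ((z , t) ∷ M))) +
    ∑pick p (λ i p′ → edge (i , t) * (Π (above (suc t) i) p′ * Z (suc t) (suc t) (fr ++ p′) ys))
      ≈⟨ +-cong (sym rest)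
           (∑pick-pending P (λ i → edge (i , t)) y e-new e-old (λ p′ → Z (suc t) (suc t) (fr ++ p′) ys) v hyp) ⟩
    Z (suc t) (suc t) (fr ++ p) (t ∷ ys) + q ^ length new * (y * [ length old ]) * v ∎
    where
    open Pending P
    p = new ++ old
    p≤t : All (_< suc t) p
    p≤t = All.++⁺ new< old<

    future : ∀ {z} → t < z → ∀ zs → ∑match (zs ++ p) ys (λ M → W (suc t) t ((z , t) ∷ M)) ≈
             ∑match (zs ++ p) ys (λ M → W (suc t) (suc t) ((z , t) ∷ M))
    future t<z zs = ∑match-cong (trivial (zs ++ p)) ys≢t λ all →
      W-cong (trans (live-1 (suc t) t (λ (r , _) → ℕ.<⇒≱ r t<z))
                      (sym (live-1 (suc t) (suc t) (λ (r , _) → ℕ.<⇒≱ r t<z)))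
              ∷ All.map (λ {e} p → live-col t {proj₁ e} (proj₂ p)) all)

    close : ∀ {i} → i < suc t → ∀ p′ → ∑match (fr ++ p′) ys (λ M → W (suc t) t ((i , t) ∷ M)) ≈
            edge (i , t) * (Π (above (suc t) i) p′ * Z (suc t) (suc t) (fr ++ p′) ys)
    close {i} i≤t p′ = begin
      ∑match (fr ++ p′) ys (λ M → live (suc t) t (i , t) * Π (χ₂ (i , t)) M * W (suc t) t M)
        ≈⟨ ∑match-cong (trivial (fr ++ p′)) ys≢t (λ {M} all → trans (*-assoc _ _ _)
             (*-cong (live-1 (suc t) t (λ (_ , r) → ℕ.<-irrefl ≡.refl r))
               (trans (W-Π (i , t) (above (suc t) i ∘ proj₁) (All.map (χ₂-col t i _ _ i≤t ∘ proj₂) all))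
                        (*-congˡ (W-cong (All.map (λ {e} p → live-col t {proj₁ e} (proj₂ p)) all)))))) ⟩
      ∑match (fr ++ p′) ys (λ M → edge (i , t) * (Π (above (suc t) i ∘ proj₁) M * W (suc t) (suc t) M))
        ≈⟨ ∑match-* (fr ++ p′) ys _ _ ⟩
      edge (i , t) * ∑match (fr ++ p′) ys (λ M → Π (above (suc t) i ∘ proj₁) M * W (suc t) (suc t) M)
        ≈⟨ *-congˡ (∑match-Πrow (above (suc t) i) (fr ++ p′) ys _) ⟩
      edge (i , t) * (Π (above (suc t) i) (fr ++ p′) * Z (suc t) (suc t) (fr ++ p′) ys)
        ≈⟨ *-congˡ (*-congʳ (trans (Π-++ (above (suc t) i) fr) (trans
             (*-congʳ (Π-above-1 (suc t) i (All.map (λ t<k (_ , k≤t) → ℕ.<⇒≱ k≤t t<k) t<fr))) (*-identityˡ _)))) ⟩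
      edge (i , t) * (Π (above (suc t) i) p′ * Z (suc t) (suc t) (fr ++ p′) ys) ∎

    rest : Z (suc t) (suc t) (fr ++ p) (t ∷ ys) ≈
           ∑pick fr (λ z zs → ∑match (zs ++ p) ys (λ M → W (suc t) (suc t) ((z , t) ∷ M)))
    rest = trans (∑match-column (fr ++ p) t ys (W-symmetric (suc t) (suc t)))
      (trans (∑pick-++ fr p _) (trans (+-congˡ (trans
      (∑pick-cong p λ {i} {p′} k → ∑match-0 (fr ++ p′) ys (W-dead (suc t) (suc t) (proj₁ (Pick-All k p≤t)) ℕ.≤-refl))
      (∑pick-0 p))) (+-identityʳ _)))

  -- Any edge would join two pending elements and has weight 0, so only the empty matching survives.
  Z-end : ∀ t {xs ys} → All (_< t) xs → All (_< t) ys → length xs ≡ length ys → Z t t xs ys ≈ δ (length xs)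
  Z-end t {[]}     {[]} _        _  _ = refl
  Z-end t {x ∷ xs} {ys} (p ∷ ps) qs _ = trans
    (∑pick-cong ys λ {_} {zs} k → ∑match-0 xs zs (W-dead t t p (proj₁ (Pick-All k qs)))) (∑pick-0 ys)

  edge-upper : ∀ {i j} → ¬ Forbidden i j → i ≤ j → edge (i , j) ≈ y
  edge-upper {i} {j} ¬f i≤j = trans (reflexive (choose-no (forbidden? i j) ¬f))
                                     (reflexive (choose-yes (i ≤? j) i≤j))

  edge-lower : ∀ {i j} → ¬ Forbidden i j → j < i → edge (i , j) ≈ 1#
  edge-lower {i} {j} ¬f j<i = trans (reflexive (choose-no (forbidden? i j) ¬f))
                                     (reflexive (choose-no (i ≤? j) (ℕ.<⇒≱ j<i)))

  edge-forbidden : ∀ {i j} → Forbidden i j → edge (i , j) ≈ 0#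
  edge-forbidden {i} {j} f = reflexive (choose-yes (forbidden? i j) f)

-- Transfer for all permutations

module Unrestricted {c ℓ : Level} (R : CommutativeRing c ℓ) (y q : CommutativeRing.Carrier R) where
  open CommutativeRing R hiding (zero) renaming (Carrier to K)
  open Operators R y q
  open Sums R
  open Transfer R y q (λ _ _ → ⊥) (λ _ _ → no λ ())
  open import Algebra.Solver.Ring.NaturalCoefficients.Default commutativeSemiring
    using (solve; _:=_; _:+_; _:*_; con)
  open import Relation.Binary.Reasoning.Setoid setoid

  Pending-push : ∀ {t old} → Pending t [] old → Pending (suc t) [] (t ∷ old)
  Pending-push P = record
    { new< = [] ; old< = ℕ.≤-refl ∷ All.map ℕ.m<n⇒m<1+n old<
    ; decreasing = old< ∷ decreasing ; separated = [] }
    where open Pending P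

  -- No arc is forbidden, so a pending element counts as old at once and the list of new ones stays
  -- empty.
  Z-unrestricted : ∀ m t {pr pc} → Pending t [] pr → Pending t [] pc → length pr ≡ length pc →
    Z t t (upFrom t m ++ pr) (upFrom t m ++ pc) ≈ elementPower m δ (length pr)
  Z-unrestricted zero    t         Pr Pc eq = Z-end t (Pending.old< Pr) (Pending.old< Pc) eq
  Z-unrestricted (suc m) t {pr} {pc} Pr Pc eq = begin
    Z t t (t ∷ fr ++ pr) (t ∷ fr ++ pc)
      ≈⟨ row-step t (fr ++ pr) (t ∷ fr) Pc (≢-future t m (Pending.old< Pr))
           (ℕ.≤-refl ∷ All.map ℕ.<⇒≤ (upFrom-≥ (suc t) m)) []
           (All.map (edge-lower λ ()) (Pending.old< Pc))
           -- Row t has met a column, so column t finds h pending rows; it finds h+1 if row t stays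
           -- pending.
           (V h + y * [ h ] * V (pred h))
           (λ {_} {pc′} k → afterRow (Pending-suc Pr) (Pending-pick k Pc) (≡.trans eq (Pick-length k))) ⟩
    Z (suc t) t (t ∷ fr ++ pr) (t ∷ fr ++ pc) + 1# * [ length pc ] * (V h + y * [ h ] * V (pred h))
      ≈⟨ +-cong (trans (∑match-↭ˡ _ (W-symmetric (suc t) t) (↭-sym (shift t fr pr)))
                         (afterRow (Pending-push Pr) Pc (≡.cong suc eq)))
                (*-congʳ (*-congˡ (reflexive (≡.cong [_] (≡.sym eq))))) ⟩
    V (suc h) + y * [ suc h ] * V h + 1# * [ h ] * (V h + y * [ h ] * V (pred h))
      ≈⟨ solve 6 (λ a y s b h d → a :+ y :* s :* b :+ con 1 :* h :* (b :+ y :* h :* d) :=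
                                  a :+ (y :* s :+ h) :* b :+ y :* (h :* h) :* d) refl _ y [ suc h ] _ [ h ] _ ⟩
    elementOp V h ∎
    where
    V = elementPower m δ
    h = length pr
    fr = upFrom (suc t) m
    afterRow : ∀ {pr pc} → Pending (suc t) [] pr → Pending t [] pc → length pr ≡ suc (length pc) →
      Z (suc t) t (fr ++ pr) (t ∷ fr ++ pc) ≈ V (length pr) + y * [ length pr ] * V (pred (length pr))
    afterRow {pr} {pc} Pr Pc eq = begin
      Z (suc t) t (fr ++ pr) (t ∷ fr ++ pc)
        ≈⟨ column-step t fr (fr ++ pc) Pr (≢-future t m (Pending.old< Pc)) (upFrom-≥ (suc t) m)
             [] (All.map (edge-upper (λ ()) ∘ ℕ.≤-pred) (Pending.old< Pr)) (V (pred (length pr)))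
             (λ {_} {pr′} k → trans
               (Z-unrestricted m (suc t) (Pending-pick k Pr) (Pending-suc Pc)
                 (ℕ.suc-injective (≡.trans (≡.sym (Pick-length k)) eq)))
               (reflexive (≡.cong (V ∘ pred) (≡.sym (Pick-length k))))) ⟩
      Z (suc t) (suc t) (fr ++ pr) (t ∷ fr ++ pc) + 1# * (y * [ length pr ]) * V (pred (length pr))
        ≈⟨ +-cong (trans (∑match-↭ʳ (fr ++ pr) (↭-sym (shift t fr pc)))
                           (Z-unrestricted m (suc t) Pr (Pending-push Pc) eq))
                  (*-congʳ (*-identityˡ _)) ⟩
      V (length pr) + y * [ length pr ] * V (pred (length pr)) ∎

-- Transfer for generalized derangements

module Restricted {c ℓ : Level} (R : CommutativeRing c ℓ) (y q : CommutativeRing.Carrier R)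
                  (seg : ℕ → ℕ) where
  open CommutativeRing R hiding (zero) renaming (Carrier to K)
  open Operators R y q
  open Sums R
  open Transfer R y q (λ i j → seg i ≡ seg j) (λ i j → seg i ℕ.≟ seg j)
  open import Algebra.Properties.Semiring.Exp semiring using (_^_)
  open import Algebra.Solver.Ring.NaturalCoefficients.Default commutativeSemiring
    using (solve; _:=_; _:+_; _:*_)
  open import Relation.Binary.Reasoning.Setoid setoid

  -- L is the number of the current segment. A strictly smaller segment number suffices to make an
  -- old element an allowed partner.
  record Block (t L : ℕ) (new old : List ℕ) : Set where
    field
      pending        : Pending t new old
      new-decreasing : AllPairs _>_ new
      new-segment    : All (λ k → seg k ≡ L) new
      old-segment    : All (λ k → seg k < L) old
    open Pending pending public

  private
    variable
      t L j : ℕ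
      new old old′ nr or nc oc : List ℕ

  Block-pick : Pick old j old′ → Block t L new old → Block t L new old′
  Block-pick k B = record
    { pending = Pending-pick k pending ; new-decreasing = new-decreasing
    ; new-segment = new-segment ; old-segment = proj₂ (Pick-All k old-segment) }
    where open Block B

  Block-suc : Block t L new old → Block (suc t) L new old
  Block-suc B = record
    { pending = Pending-suc pending ; new-decreasing = new-decreasing
    ; new-segment = new-segment ; old-segment = old-segment }
    where open Block B

  Block-push : seg t ≡ L → Block t L new old → Block (suc t) L (t ∷ new) old
  Block-push s B = record
    { pending = record
      { new< = ℕ.≤-refl ∷ All.map ℕ.m<n⇒m<1+n new< ; old< = All.map ℕ.m<n⇒m<1+n old<
      ; decreasing = decreasing ; separated = old< ∷ separated }
    ; new-decreasing = new< ∷ new-decreasing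
    ; new-segment = s ∷ new-segment ; old-segment = old-segment }
    where open Block B

  -- At the end of a segment its pending elements become allowed partners, and the decreasing order
  -- survives because they are younger than the old ones.
  Block-merge : Block t L new old → Block t (suc L) [] (new ++ old)
  Block-merge B = record
    { pending = record
      { new< = [] ; old< = All.++⁺ new< old<
      ; decreasing = AllPairs.++⁺ new-decreasing decreasing separated ; separated = [] }
    ; new-decreasing = [] ; new-segment = []
    ; old-segment = All.++⁺ (All.map (λ p → ℕ.s≤s (ℕ.≤-reflexive p)) new-segment)
                            (All.map ℕ.m<n⇒m<1+n old-segment) }
    where open Block B

  module _ (V : ℕ → K) (N L e : ℕ)
    (rest : ∀ {pr pc} → Block e (suc L) [] pr → Block e (suc L) [] pc → length pr ≡ length pc →
            Z e e (upFrom e N ++ pr) (upFrom e N ++ pc) ≈ V (length pr)) where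

    -- Induction on the n unread elements of the segment ending before e, where `rest` takes over.
    -- Reading a row and then a column reproduces `afterC-step` and then `afterR-step`.
    Z-segment : ∀ n t → t ℕ.+ n ≡ e → (∀ i → t ≤ i → i < e → seg i ≡ L) →
      Block t L nr or → Block t L nc oc → length or ℕ.+ length nr ≡ length oc ℕ.+ length nc →
      Z t t (upFrom t (n ℕ.+ N) ++ (nr ++ or)) (upFrom t (n ℕ.+ N) ++ (nc ++ oc)) ≈
      afterC n V (length or) (length nr) (length oc) (length nc)
    Z-segment {nr = nr} {or} {nc} {oc} zero t t+n≡e sg Br Bc eq
      rewrite ≡.trans (≡.sym (ℕ.+-identityʳ t)) t+n≡e = begin
      Z e e (upFrom e N ++ (nr ++ or)) (upFrom e N ++ (nc ++ oc))
        ≈⟨ rest (Block-merge Br) (Block-merge Bc) (≡.trans (len nr or) (≡.trans eq (≡.sym (len nc oc)))) ⟩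
      V (length (nr ++ or))
        ≡⟨ ≡.cong V (len nr or) ⟩
      V (length or ℕ.+ length nr)
        ≈⟨ afterC-end V (length or) (length nr) (length oc) (length nc) ⟨
      afterC 0 V (length or) (length nr) (length oc) (length nc) ∎
      where
      len : ∀ (xs ys : List ℕ) → length (xs ++ ys) ≡ length ys ℕ.+ length xs
      len xs ys = ≡.trans (length-++ xs) (ℕ.+-comm (length xs) (length ys))
    Z-segment {nr = nr} {or} {nc} {oc} (suc n) t t+n≡e sg Br Bc eq = begin
      Z t t (t ∷ fr ++ (nr ++ or)) (t ∷ fr ++ (nc ++ oc))
        ≈⟨ row-step t (fr ++ (nr ++ or)) (t ∷ fr) (Block.pending Bc)
             (≢-future t (n ℕ.+ N) (Pending-all (Block.pending Br)))
             (ℕ.≤-refl ∷ All.map ℕ.<⇒≤ (upFrom-≥ (suc t) (n ℕ.+ N)))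
             (All.map (λ s → edge-forbidden (≡.trans seg-t (≡.sym s))) (Block.new-segment Bc))
             (All.zipWith (λ (s , j<t) → edge-lower (λ s′ → ℕ.<⇒≢ s (≡.trans (≡.sym s′) seg-t)) j<t)
               (Block.old-segment Bc , Block.old< Bc))
             -- `pred (length oc)` stands for the length of the remainder, so that the value does
             -- not depend on the column met.
             (afterR n V (length or) (length nr) (pred (length oc)) (length nc))
             (λ {_} {oc′} k → trans
               (afterRow (Block-suc Br) (Block-pick k Bc)
                 (≡.trans eq (≡.cong (ℕ._+ length nc) (Pick-length k))))
               (reflexive (≡.cong (λ b → afterR n V (length or) (length nr) (pred b) (length nc)) (≡.sym (Pick-length k))))) ⟩
      Z (suc t) t (t ∷ fr ++ (nr ++ or)) (t ∷ fr ++ (nc ++ oc)) +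
      q ^ length nc * [ length oc ] * afterR n V (length or) (length nr) (pred (length oc)) (length nc)
        ≈⟨ +-congʳ (trans (∑match-↭ˡ _ (W-symmetric (suc t) t) (↭-sym (shift t fr (nr ++ or))))
             (afterRow (Block-push seg-t Br) Bc (≡.trans (ℕ.+-suc (length or) (length nr)) (≡.cong suc eq)))) ⟩
      afterR n V (length or) (suc (length nr)) (length oc) (length nc) +
      q ^ length nc * [ length oc ] * afterR n V (length or) (length nr) (pred (length oc)) (length nc)
        ≈⟨ afterC-step n V (length or) (length nr) (length oc) (length nc) ⟨
      afterC (suc n) V (length or) (length nr) (length oc) (length nc) ∎
      where
      fr = upFrom (suc t) (n ℕ.+ N)
      suc-t : suc t ℕ.+ n ≡ e
      suc-t = ≡.trans (≡.sym (ℕ.+-suc t n)) t+n≡e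
      sg′ : ∀ i → suc t ≤ i → i < e → seg i ≡ L
      sg′ i = sg i ∘ ℕ.<⇒≤
      seg-t : seg t ≡ L
      seg-t = sg t ℕ.≤-refl (≡.subst (t <_) suc-t (ℕ.m≤m+n (suc t) n))
      afterRow : ∀ {nr or nc oc} → Block (suc t) L nr or → Block t L nc oc →
        length or ℕ.+ length nr ≡ suc (length oc ℕ.+ length nc) →
        Z (suc t) t (fr ++ (nr ++ or)) (t ∷ fr ++ (nc ++ oc)) ≈
        afterR n V (length or) (length nr) (length oc) (length nc)
      afterRow {nr} {or} {nc} {oc} Br Bc eq = begin
        Z (suc t) t (fr ++ (nr ++ or)) (t ∷ fr ++ (nc ++ oc))
          ≈⟨ column-step t fr (fr ++ (nc ++ oc)) (Block.pending Br)
               (≢-future t (n ℕ.+ N) (Pending-all (Block.pending Bc))) (upFrom-≥ (suc t) (n ℕ.+ N))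
               (All.map (λ s → edge-forbidden (≡.trans s (≡.sym seg-t))) (Block.new-segment Br))
               (All.zipWith (λ (s , i≤t) → edge-upper (λ s′ → ℕ.<⇒≢ s (≡.trans s′ seg-t)) (ℕ.≤-pred i≤t))
                 (Block.old-segment Br , Block.old< Br))
               (afterC n V (pred (length or)) (length nr) (length oc) (length nc))
               (λ {_} {or′} k → trans
                 (Z-segment n (suc t) suc-t sg′ (Block-pick k Br) (Block-suc Bc)
                   (ℕ.suc-injective (≡.trans (≡.cong (ℕ._+ length nr) (≡.sym (Pick-length k))) eq)))
                 (reflexive (≡.cong (λ a → afterC n V (pred a) (length nr) (length oc) (length nc)) (≡.sym (Pick-length k))))) ⟩
        Z (suc t) (suc t) (fr ++ (nr ++ or)) (t ∷ fr ++ (nc ++ oc)) +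
        q ^ length nr * (y * [ length or ]) * afterC n V (pred (length or)) (length nr) (length oc) (length nc)
          ≈⟨ +-cong (trans (∑match-↭ʳ (fr ++ (nr ++ or)) (↭-sym (shift t fr (nc ++ oc))))
                 (Z-segment n (suc t) suc-t sg′ Br (Block-push seg-t Bc)
                   (≡.trans eq (≡.sym (ℕ.+-suc (length oc) (length nc))))))
               (solve 4 (λ p y a x → p :* (y :* a) :* x := y :* p :* a :* x) refl (q ^ length nr) y _ _) ⟩
        afterC n V (length or) (length nr) (length oc) (suc (length nc)) +
        y * q ^ length nr * [ length or ] * afterC n V (pred (length or)) (length nr) (length oc) (length nc)
          ≈⟨ afterR-step n V (length or) (length nr) (length oc) (length nc) ⟨
        afterR n V (length or) (length nr) (length oc) (length nc) ∎

  -- Positions are taken relative to t and segment numbers relative to L, so that the induction can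
  -- discard the first segment.
  Z-restricted : ∀ {k} (ns : Vec ℕ k) t L → (∀ i → seg (t ℕ.+ i) ≡ L ℕ.+ segmentℕ ns i) →
    ∀ {pr pc} → Block t L [] pr → Block t L [] pc → length pr ≡ length pc →
    Z t t (upFrom t (Vec.sum ns) ++ pr) (upFrom t (Vec.sum ns) ++ pc) ≈ segmentOps ns δ (length pr)
  Z-restricted []       t L sg Br Bc eq = Z-end t (Block.old< Br) (Block.old< Bc) eq
  Z-restricted (n ∷ ns) t L sg {pr} {pc} Br Bc eq = begin
    Z t t (upFrom t (n ℕ.+ Vec.sum ns) ++ pr) (upFrom t (n ℕ.+ Vec.sum ns) ++ pc)
      ≈⟨ Z-segment (segmentOps ns δ) (Vec.sum ns) L (t ℕ.+ n) (Z-restricted ns (t ℕ.+ n) (suc L) sg-rest)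
           n t ≡.refl sg-here Br Bc (≡.cong (ℕ._+ 0) eq) ⟩
    afterC n (segmentOps ns δ) (length pr) 0 (length pc) 0
      ≡⟨ ≡.cong (λ b → afterC n (segmentOps ns δ) (length pr) 0 b 0) (≡.sym eq) ⟩
    afterC n (segmentOps ns δ) (length pr) 0 (length pr) 0
      ≈⟨ afterC-start n (segmentOps ns δ) (length pr) ⟩
    segmentOp n (segmentOps ns δ) (length pr) ∎
    where
    sg-here : ∀ i → t ≤ i → i < t ℕ.+ n → seg i ≡ L
    sg-here i t≤i i<t+n = ≡.trans (≡.cong seg (≡.sym (ℕ.m+[n∸m]≡n t≤i))) (≡.trans (sg (i ∸ t))
      (≡.trans (≡.cong (L ℕ.+_) (choose-yes (i ∸ t <? n)
        (ℕ.+-cancelˡ-< t _ _ (≡.subst (_< t ℕ.+ n) (≡.sym (ℕ.m+[n∸m]≡n t≤i)) i<t+n)))) (ℕ.+-identityʳ L)))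
    sg-rest : ∀ i → seg (t ℕ.+ n ℕ.+ i) ≡ suc L ℕ.+ segmentℕ ns i
    sg-rest i = ≡.trans (≡.cong seg (ℕ.+-assoc t n i)) (≡.trans (sg (n ℕ.+ i))
      (≡.trans (≡.cong (L ℕ.+_) (≡.trans (choose-no (n ℕ.+ i <? n) (ℕ.m+n≮m n i))
        (≡.cong (suc ∘ segmentℕ ns) (ℕ.m+n∸m≡n n i)))) (ℕ.+-suc L _)))

-- Evaluation of polynomials at an operator

module Evaluation {c ℓ : Level} (R : CommutativeRing c ℓ) where
  open CommutativeRing R renaming (Carrier to K)
  open Polynomials R
  open import Algebra.Solver.Ring.NaturalCoefficients.Default commutativeSemiring
    using (solve; _:=_; _:+_; _:*_)
  open import Relation.Binary.Reasoning.Setoid setoid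

  Operator : Set c
  Operator = (ℕ → K) → ℕ → K

  -- Congruence is part of linearity because operators act on functions that are compared only
  -- pointwise and up to `≈`.
  record Linear (Y : Operator) : Set (c ⊔ ℓ) where
    field
      cong   : ∀ {v w} → (∀ i → v i ≈ w i) → ∀ h → Y v h ≈ Y w h
      homo-+ : ∀ v w h → Y (λ i → v i + w i) h ≈ Y v h + Y w h
      homo-* : ∀ k v h → Y (λ i → k * v i) h ≈ k * Y v h

    homo-0 : ∀ h → Y (λ _ → 0#) h ≈ 0#
    homo-0 h = trans (cong (λ _ → sym (zeroˡ 0#)) h) (trans (homo-* 0# (λ _ → 0#) h) (zeroˡ _))

  -- Horner's scheme for f(Y) applied to v.
  eval : Operator → Poly → Operator
  eval Y []      v h = 0#
  eval Y (a ∷ f) v h = a * v h + Y (eval Y f v) h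

  module _ {Y : Operator} (linear : Linear Y) where
    open Linear linear

    eval-linear : ∀ f → Linear (eval Y f)
    eval-linear f = record { cong = eval-cong f ; homo-+ = eval-homo-+ f ; homo-* = eval-homo-* f }
      where
      eval-cong : ∀ f {v w} → (∀ i → v i ≈ w i) → ∀ h → eval Y f v h ≈ eval Y f w h
      eval-cong []      p h = refl
      eval-cong (a ∷ f) p h = +-cong (*-congˡ (p h)) (cong (eval-cong f p) h)

      eval-homo-+ : ∀ f v w h → eval Y f (λ i → v i + w i) h ≈ eval Y f v h + eval Y f w h
      eval-homo-+ []      v w h = sym (+-identityˡ _)
      eval-homo-+ (a ∷ f) v w h = trans (+-congˡ (trans (cong (eval-homo-+ f v w) h) (homo-+ _ _ h)))
        (solve 5 (λ a v w x z → a :* (v :+ w) :+ (x :+ z) := a :* v :+ x :+ (a :* w :+ z)) refl a (v h) (w h) _ _)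

      eval-homo-* : ∀ f k v h → eval Y f (λ i → k * v i) h ≈ k * eval Y f v h
      eval-homo-* []      k v h = sym (zeroʳ k)
      eval-homo-* (a ∷ f) k v h = trans (+-congˡ (trans (cong (eval-homo-* f k v) h) (homo-* k _ h)))
        (solve 4 (λ a k v x → a :* (k :* v) :+ k :* x := k :* (a :* v :+ x)) refl a k (v h) _)

    eval-constant : ∀ a v h → eval Y (constant a) v h ≈ a * v h
    eval-constant a v h = trans (+-congˡ (homo-0 h)) (+-identityʳ _)

    eval-X : ∀ v h → eval Y X v h ≈ Y v h
    eval-X v h = begin
      0# * v h + Y (eval Y (constant 1#) v) h
        ≈⟨ +-cong (zeroˡ _) (cong (λ i → trans (eval-constant 1# v i) (*-identityˡ _)) h) ⟩
      0# + Y v h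
        ≈⟨ +-identityˡ _ ⟩
      Y v h ∎

    eval-+ₚ : ∀ f g v h → eval Y (f +ₚ g) v h ≈ eval Y f v h + eval Y g v h
    eval-+ₚ []      g       v h = sym (+-identityˡ _)
    eval-+ₚ (a ∷ f) []      v h = sym (+-identityʳ _)
    eval-+ₚ (a ∷ f) (b ∷ g) v h = trans (+-congˡ (trans (cong (eval-+ₚ f g v) h) (homo-+ _ _ h)))
      (solve 5 (λ a b v x z → (a :+ b) :* v :+ (x :+ z) := a :* v :+ x :+ (b :* v :+ z)) refl a b (v h) _ _)

    eval-·ₚ : ∀ k f v h → eval Y (k ·ₚ f) v h ≈ k * eval Y f v h
    eval-·ₚ k []      v h = sym (zeroʳ k)
    eval-·ₚ k (a ∷ f) v h = trans (+-congˡ (trans (cong (eval-·ₚ k f v) h) (homo-* k _ h)))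
      (solve 4 (λ a k v x → k :* a :* v :+ k :* x := k :* (a :* v :+ x)) refl a k (v h) _)

    eval-*ₚ : ∀ f g v h → eval Y (f *ₚ g) v h ≈ eval Y f (eval Y g v) h
    eval-*ₚ []      g v h = refl
    eval-*ₚ (a ∷ f) g v h = begin
      eval Y (a ·ₚ g +ₚ (0# ∷ f *ₚ g)) v h
        ≈⟨ eval-+ₚ (a ·ₚ g) _ v h ⟩
      eval Y (a ·ₚ g) v h + (0# * v h + Y (eval Y (f *ₚ g) v) h)
        ≈⟨ +-cong (eval-·ₚ a g v h) (trans (+-congʳ (zeroˡ _)) (trans (+-identityˡ _) (cong (eval-*ₚ f g v) h))) ⟩
      a * eval Y g v h + Y (eval Y f (eval Y g v)) h ∎

    eval-∘ : ∀ f g v h → eval Y (f [ g ]ₚ) v h ≈ eval (eval Y g) f v h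
    eval-∘ []      g v h = refl
    eval-∘ (a ∷ f) g v h = begin
      eval Y (constant a +ₚ g *ₚ (f [ g ]ₚ)) v h
        ≈⟨ eval-+ₚ (constant a) (g *ₚ (f [ g ]ₚ)) v h ⟩
      eval Y (constant a) v h + eval Y (g *ₚ (f [ g ]ₚ)) v h
        ≈⟨ +-cong (eval-constant a v h) (trans (eval-*ₚ g (f [ g ]ₚ) v h)
             (Linear.cong (eval-linear g) (eval-∘ f g v) h)) ⟩
      a * v h + eval Y g (eval (eval Y g) f v) h ∎

  -- Additivity in the moment sequence for a fixed polynomial; it serves to move `elementOp` inside
  -- the functional.
  linearFunctional-+ : ∀ f (μ ν : ℕ → K) →
    linearFunctional (λ m → μ m + ν m) f ≈ linearFunctional μ f + linearFunctional ν f
  linearFunctional-+ []      μ ν = sym (+-identityˡ _)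
  linearFunctional-+ (a ∷ f) μ ν = trans (+-congˡ (linearFunctional-+ f _ _))
    (solve 5 (λ a v w x z → a :* (v :+ w) :+ (x :+ z) := a :* v :+ x :+ (a :* w :+ z)) refl a (μ 0) (ν 0) _ _)

  linearFunctional-* : ∀ f k (μ : ℕ → K) → linearFunctional (λ m → k * μ m) f ≈ k * linearFunctional μ f
  linearFunctional-* []      k μ = sym (zeroʳ k)
  linearFunctional-* (a ∷ f) k μ = trans (+-congˡ (linearFunctional-* f k _))
    (solve 4 (λ a k v x → a :* (k :* v) :+ k :* x := k :* (a :* v :+ x)) refl a k (μ 0) _)

  linearFunctional-cong : ∀ f {μ ν : ℕ → K} → (∀ m → μ m ≈ ν m) → linearFunctional μ f ≈ linearFunctional ν f
  linearFunctional-cong []      p = refl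
  linearFunctional-cong (a ∷ f) p = +-cong (*-congˡ (p 0)) (linearFunctional-cong f (p ∘ suc))

-- The q-Laguerre polynomials evaluated at the element operator

module Laguerre {c ℓ : Level} (R : CommutativeRing c ℓ) (P : Parameters R) where
  open CommutativeRing R renaming (Carrier to K)
  open Parameters P
  open Polynomials R
  open AlSalamChihara R
  open QLaguerre R P
  open Evaluation R
  open Operators R y q
  open import Algebra.Properties.Semiring.Exp semiring using (_^_)
  open import Algebra.Properties.Ring ring using (-1*x≈-x; -‿involutive)
  open import Algebra.Solver.Ring.NaturalCoefficients.Default commutativeSemiring
    using (solve; _:=_; _:+_; _:*_; con)
  open import Relation.Binary.Reasoning.Setoid setoid

  elementOp-linear : Linear elementOp
  elementOp-linear = record
    { cong   = λ p h → +-cong (+-cong (p _) (*-congˡ (p _))) (*-congˡ (p _))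
    ; homo-+ = λ v w h → solve 8 (λ a b k x z l d e →
        a :+ b :+ k :* (x :+ z) :+ l :* (d :+ e) := (a :+ k :* x :+ l :* d) :+ (b :+ k :* z :+ l :* e)) refl
        (v (suc h)) (w (suc h)) _ (v h) (w h) _ (v (pred h)) (w (pred h))
    ; homo-* = λ k v h → solve 6 (λ k a b x d e →
        k :* a :+ b :* (k :* x) :+ d :* (k :* e) := k :* (a :+ b :* x :+ d :* e)) refl
        k (v (suc h)) _ (v h) _ (v (pred h)) }

  eval-linearFunctional : ∀ f v h → eval elementOp f v h ≈ linearFunctional (λ m → elementPower m v h) f
  eval-linearFunctional []      v h = refl
  eval-linearFunctional (a ∷ f) v h = +-congˡ (begin
    elementOp (eval elementOp f v) h
      ≈⟨ Linear.cong elementOp-linear (eval-linearFunctional f v) h ⟩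
    elementOp (λ i → linearFunctional (λ m → elementPower m v i) f) h
      ≈⟨ +-cong (+-congˡ (linearFunctional-* f _ _)) (linearFunctional-* f _ _) ⟨
    _ ≈⟨ +-congʳ (linearFunctional-+ f _ _) ⟨
    _ ≈⟨ linearFunctional-+ f _ _ ⟨
    linearFunctional (λ m → elementOp (elementPower m v) h) f ∎)

  private
    -- The solver works over commutative semirings, so -1 is an atom whose laws `1+-1≈0` and
    -- `-1*-1≈1` are applied by hand.
    -1ᴷ s r α β : K
    -1ᴷ = - 1#
    s = √y * [q-1]⁻¹
    r = [q-1]⁻¹
    α = √y⁻¹
    β = √y * q

    1+-1≈0 : 1# + -1ᴷ ≈ 0#
    1+-1≈0 = -‿inverseʳ 1#

    -1*-1≈1 : -1ᴷ * -1ᴷ ≈ 1#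
    -1*-1≈1 = trans (-1*x≈-x -1ᴷ) (-‿involutive 1#)

    r-inverse : r * (q + -1ᴷ) ≈ 1#
    r-inverse = trans (*-comm _ _) [q-1]-inverse

    cancel : ∀ x → x + -1ᴷ * x ≈ 0#
    cancel x = trans (solve 2 (λ x m → x :+ m :* x := (con 1 :+ m) :* x) refl x -1ᴷ)
                     (trans (*-congʳ 1+-1≈0) (zeroˡ x))

  []-closed : ∀ k → [ k ] ≈ r * (q ^ k + -1ᴷ)
  []-closed zero    = sym (trans (*-congˡ 1+-1≈0) (zeroʳ r))
  []-closed (suc k) = begin
    1# + q * [ k ]
      ≈⟨ +-cong (sym r-inverse) (*-congˡ ([]-closed k)) ⟩
    r * (q + -1ᴷ) + q * (r * (q ^ k + -1ᴷ))
      ≈⟨ solve 4 (λ r q m p → r :* (q :+ m) :+ q :* (r :* (p :+ m)) := r :* (q :* p :+ m) :+ r :* (q :+ m :* q)) refl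
           r q -1ᴷ (q ^ k) ⟩
    r * (q ^ suc k + -1ᴷ) + r * (q + -1ᴷ * q)
      ≈⟨ +-congˡ (trans (*-congˡ (cancel q)) (zeroʳ r)) ⟩
    r * (q ^ suc k + -1ᴷ) + 0#
      ≈⟨ +-identityʳ _ ⟩
    r * (q ^ suc k + -1ᴷ) ∎

  argument : Poly
  argument = (½ * √y⁻¹) ·ₚ ((q - 1#) ·ₚ X +ₚ constant (y + 1#))

  private
    Y : Operator
    Y = eval elementOp argument

    Y-linear : Linear Y
    Y-linear = eval-linear elementOp-linear argument

    Y≈ : ∀ w h → Y w h ≈ ½ * √y⁻¹ * ((q + -1ᴷ) * elementOp w h + (y + 1#) * w h)
    Y≈ w h = trans (eval-·ₚ elementOp-linear _ ((q - 1#) ·ₚ X +ₚ constant (y + 1#)) w h)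
      (*-congˡ (trans (eval-+ₚ elementOp-linear ((q - 1#) ·ₚ X) (constant (y + 1#)) w h)
      (+-cong (trans (eval-·ₚ elementOp-linear _ X w h) (*-congˡ (eval-X elementOp-linear w h)))
              (eval-constant elementOp-linear _ w h))))

    -- With s = √y/(q-1), the scaled argument 2s((q-1)x+y+1)/(2√y) is x + (y+1)/(q-1), and s(α+β)q^k
    -- is (1+yq)q^k/(q-1). Their constants combine to -(y[k+1]+[k]).
    step : ∀ k w h →
      s * ((1# + 1#) * Y w h + -1ᴷ * ((α + β) * q ^ k * w h)) ≈
      elementOp w h + -1ᴷ * ((y * [ suc k ] + [ k ]) * w h)
    step k w h = begin
      s * ((1# + 1#) * Y w h + -1ᴷ * ((α + β) * p * w h))
        ≈⟨ *-congˡ (+-congʳ (*-congˡ (Y≈ w h))) ⟩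
      √y * r * ((1# + 1#) * (½ * α * ((q + -1ᴷ) * x + (y + 1#) * z)) + -1ᴷ * ((α + √y * q) * p * z))
        ≈⟨ solve 10 (λ u r ½ α q m x y p z →
             u :* r :* ((con 1 :+ con 1) :* (½ :* α :* ((q :+ m) :* x :+ (y :+ con 1) :* z)) :+ m :* ((α :+ u :* q) :* p :* z)) :=
             (u :* α) :* ((con 1 :+ con 1) :* ½) :* (r :* (q :+ m) :* x :+ r :* (y :+ con 1) :* z) :+
             m :* r :* ((u :* α) :+ (u :* u) :* q) :* p :* z) refl
             √y r ½ α q -1ᴷ x y p z ⟩
      √y * α * ((1# + 1#) * ½) * (r * (q + -1ᴷ) * x + r * (y + 1#) * z) + -1ᴷ * r * (√y * α + √y * √y * q) * p * z
        ≈⟨ +-cong (*-cong (*-cong √y-inverse 2-inverse) (+-congʳ (*-congʳ r-inverse)))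
                  (*-congʳ (*-congʳ (*-congˡ (+-cong √y-inverse (*-congʳ √y-square))))) ⟩
      1# * 1# * (1# * x + r * (y + 1#) * z) + -1ᴷ * r * (1# + y * q) * p * z
        -- A factor (-1)² is inserted so that all constant terms can be collected under a common -1.
        ≈⟨ +-congʳ (*-congˡ (+-congˡ (trans (*-congʳ -1*-1≈1) (*-identityˡ _)))) ⟨
      1# * 1# * (1# * x + -1ᴷ * -1ᴷ * (r * (y + 1#) * z)) + -1ᴷ * r * (1# + y * q) * p * z
        ≈⟨ solve 7 (λ r q m x y p z →
             con 1 :* con 1 :* (con 1 :* x :+ m :* m :* (r :* (y :+ con 1) :* z)) :+ m :* r :* (con 1 :+ y :* q) :* p :* z :=
             x :+ m :* ((y :* (r :* (q :* p :+ m)) :+ r :* (p :+ m)) :* z)) refl r q -1ᴷ x y p z ⟩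
      x + -1ᴷ * ((y * (r * (q * p + -1ᴷ)) + r * (p + -1ᴷ)) * z)
        ≈⟨ +-congˡ (*-congˡ (*-congʳ (+-cong (*-congˡ ([]-closed (suc k))) ([]-closed k)))) ⟨
      x + -1ᴷ * ((y * [ suc k ] + [ k ]) * z) ∎
      where
      p = q ^ k
      x = elementOp w h
      z = w h

    -- Since αβ = q, both factors are 1 - q^(n+1), and s² = y/(q-1)².
    square : ∀ n → s * s * ((1# - q ^ suc n) * (1# - α * β * q ^ n)) ≈ y * ([ suc n ] * [ suc n ])
    square n = begin
      s * s * ((1# - p) * (1# - α * β * q ^ n))
        ≈⟨ *-congˡ (*-cong (factor refl) (factor (begin
             α * (√y * q) * q ^ n ≈⟨ solve 4 (λ a u q p → a :* (u :* q) :* p := u :* a :* (q :* p)) refl α √y q (q ^ n) ⟩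
             √y * α * p           ≈⟨ *-congʳ √y-inverse ⟩
             1# * p               ≈⟨ *-identityˡ p ⟩
             p ∎))) ⟩
      √y * r * (√y * r) * (-1ᴷ * (p + -1ᴷ) * (-1ᴷ * (p + -1ᴷ)))
        ≈⟨ solve 4 (λ u r m x → u :* r :* (u :* r) :* (m :* x :* (m :* x)) := u :* u :* (m :* m) :* (r :* x :* (r :* x))) refl
             √y r -1ᴷ (p + -1ᴷ) ⟩
      √y * √y * (-1ᴷ * -1ᴷ) * (r * (p + -1ᴷ) * (r * (p + -1ᴷ)))
        ≈⟨ *-cong (trans (*-cong √y-square -1*-1≈1) (*-identityʳ y)) (*-cong (sym ([]-closed (suc n))) (sym ([]-closed (suc n)))) ⟩
      y * ([ suc n ] * [ suc n ]) ∎
      where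
      p = q ^ suc n
      factor : ∀ {x} → x ≈ p → 1# - x ≈ -1ᴷ * (p + -1ᴷ)
      factor {x} eq = begin
        1# - x               ≈⟨ +-cong (sym -1*-1≈1) (trans (-‿cong eq) (sym (-1*x≈-x p))) ⟩
        -1ᴷ * -1ᴷ + -1ᴷ * p  ≈⟨ solve 2 (λ m p → m :* m :+ m :* p := m :* (p :+ m)) refl -1ᴷ p ⟩
        -1ᴷ * (p + -1ᴷ) ∎

    D : ℕ → (ℕ → K) → ℕ → K
    D n = eval Y (Q α β q n)

    eval-factor : ∀ k w h → eval Y ((1# + 1#) ·ₚ X -ₚ constant k) w h ≈ (1# + 1#) * Y w h + -1ᴷ * (k * w h)
    eval-factor k w h = trans (eval-+ₚ Y-linear ((1# + 1#) ·ₚ X) (-1ᴷ ·ₚ constant k) w h) (+-cong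
      (trans (eval-·ₚ Y-linear (1# + 1#) X w h) (*-congˡ (eval-X Y-linear w h)))
      (trans (eval-·ₚ Y-linear -1ᴷ (constant k) w h) (*-congˡ (eval-constant Y-linear k w h))))

    drop : ∀ {a b x z} → (x + a + b) + -1ᴷ * a + -1ᴷ * b ≈ z → x ≈ z
    drop {a} {b} {x} {z} p = begin
      x                                   ≈⟨ trans (+-congˡ (+-identityˡ 0#)) (+-identityʳ x) ⟨
      x + (0# + 0#)                       ≈⟨ +-congˡ (+-cong (cancel a) (cancel b)) ⟨
      x + ((a + -1ᴷ * a) + (b + -1ᴷ * b)) ≈⟨ solve 4 (λ x a b m →
        x :+ ((a :+ m :* a) :+ (b :+ m :* b)) := (x :+ a :+ b) :+ m :* a :+ m :* b) refl x a b -1ᴷ ⟩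
      (x + a + b) + -1ᴷ * a + -1ᴷ * b     ≈⟨ p ⟩
      z ∎

    -- Both sides satisfy one three-term recurrence: the left by `step` and `square`, the right by
    -- `segmentOp-recurrence`, solved for its leading term with `drop`. At n = 1 the coefficient
    -- [0]² removes the third term.
    scaled : ∀ n v h → s ^ n * D n v h ≈ segmentOp n v h
    scaled zero          v h = begin
      1# * eval Y (constant 1#) v h ≈⟨ trans (*-identityˡ _) (trans (eval-constant Y-linear 1# v h) (*-identityˡ _)) ⟩
      v h                           ≈⟨ segmentOp-zero v h ⟨
      segmentOp 0 v h ∎
    scaled (suc zero)    v h = sym (drop (begin
      segmentOp 1 v h + B * segmentOp 0 v h + y * (0# * 0#) * segmentOp 0 v h
        + -1ᴷ * (B * segmentOp 0 v h) + -1ᴷ * (y * (0# * 0#) * segmentOp 0 v h)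
        ≈⟨ +-cong (+-cong (sym (segmentOp-recurrence 0 v h)) refl)
             (solve 3 (λ m y a → m :* (y :* (con 0 :* con 0) :* a) := con 0) refl -1ᴷ y _) ⟩
      elementOp (segmentOp 0 v) h + -1ᴷ * (B * segmentOp 0 v h) + 0#
        ≈⟨ trans (+-identityʳ _) (+-cong (Linear.cong elementOp-linear (segmentOp-zero v) h) (*-congˡ (*-congˡ (segmentOp-zero v h)))) ⟩
      elementOp v h + -1ᴷ * (B * v h)
        ≈⟨ step 0 v h ⟨
      s * ((1# + 1#) * Y v h + -1ᴷ * ((α + β) * 1# * v h))
        ≈⟨ *-cong (*-identityʳ s) (eval-factor _ v h) ⟨
      s * 1# * D 1 v h ∎))
      where B = y * [ 1 ] + [ 0 ]
    scaled (suc (suc n)) v h = sym (drop (begin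
      segmentOp (suc (suc n)) v h + B * A₁ + C * A₀ + -1ᴷ * (B * A₁) + -1ᴷ * (C * A₀)
        ≈⟨ +-congʳ (+-congʳ (segmentOp-recurrence (suc n) v h)) ⟨
      elementOp (segmentOp (suc n) v) h + -1ᴷ * (B * A₁) + -1ᴷ * (C * A₀)
        ≈⟨ +-cong (+-cong (trans (Linear.cong elementOp-linear (λ i → sym (scaled (suc n) v i)) h)
                             (Linear.homo-* elementOp-linear S₁ (D (suc n) v) h))
                    (*-congˡ (*-congˡ (sym (scaled (suc n) v h)))))
                  (*-congˡ (*-cong (sym (square n)) (sym (scaled n v h)))) ⟩
      S₁ * elementOp (D (suc n) v) h + -1ᴷ * (B * (S₁ * D (suc n) v h)) + -1ᴷ * (s * s * γ * (s ^ n * D n v h))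
        ≈⟨ solve 9 (λ m s S0 x B d₁ γ d₀ S1 → S1 :* x :+ m :* (B :* (S1 :* d₁)) :+ m :* (s :* s :* γ :* (S0 :* d₀)) :=
                     S1 :* (x :+ m :* (B :* d₁)) :+ s :* (s :* S0) :* (m :* (γ :* d₀))) refl
             -1ᴷ s (s ^ n) _ B (D (suc n) v h) γ (D n v h) S₁ ⟩
      S₁ * (elementOp (D (suc n) v) h + -1ᴷ * (B * D (suc n) v h)) + s * S₁ * (-1ᴷ * (γ * D n v h))
        ≈⟨ +-congʳ (*-congˡ (step (suc n) (D (suc n) v) h)) ⟨
      S₁ * (s * ((1# + 1#) * Y (D (suc n) v) h + -1ᴷ * ((α + β) * q ^ suc n * D (suc n) v h))) + s * S₁ * (-1ᴷ * (γ * D n v h))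
        ≈⟨ solve 4 (λ S s x z → S :* (s :* x) :+ s :* S :* z := s :* S :* (x :+ z)) refl S₁ s _ _ ⟩
      s * S₁ * ((1# + 1#) * Y (D (suc n) v) h + -1ᴷ * ((α + β) * q ^ suc n * D (suc n) v h) + -1ᴷ * (γ * D n v h))
        ≈⟨ *-congˡ (trans (eval-+ₚ Y-linear (factor *ₚ Q α β q (suc n)) (-1ᴷ ·ₚ (γ ·ₚ Q α β q n)) v h)
            (+-cong (trans (eval-*ₚ Y-linear factor (Q α β q (suc n)) v h) (eval-factor _ (D (suc n) v) h))
                    (trans (eval-·ₚ Y-linear -1ᴷ (γ ·ₚ Q α β q n) v h) (*-congˡ (eval-·ₚ Y-linear γ (Q α β q n) v h))))) ⟨
      s * S₁ * D (suc (suc n)) v h ∎))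
      where
      S₁ = s ^ suc n
      factor = (1# + 1#) ·ₚ X -ₚ constant ((α + β) * q ^ suc n)
      A₁ = segmentOp (suc n) v h
      A₀ = segmentOp n v h
      B = y * [ suc (suc n) ] + [ suc n ]
      C = y * ([ suc n ] * [ suc n ])
      γ = (1# - q ^ suc n) * (1# - α * β * q ^ n)

  eval-L : ∀ n v h → eval elementOp (L n) v h ≈ segmentOp n v h
  eval-L n v h = begin
    eval elementOp (L n) v h
      ≈⟨ eval-·ₚ elementOp-linear (s ^ n) (Q √y⁻¹ (√y * q) q n [ argument ]ₚ) v h ⟩
    s ^ n * eval elementOp (Q √y⁻¹ (√y * q) q n [ argument ]ₚ) v h
      ≈⟨ *-congˡ (eval-∘ elementOp-linear (Q √y⁻¹ (√y * q) q n) argument v h) ⟩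
    s ^ n * D n v h
      ≈⟨ scaled n v h ⟩
    segmentOp n v h ∎

  eval-productₚ : ∀ {k} (ns : Vec ℕ k) v h → eval elementOp (productₚ (Vec.map L ns)) v h ≈ segmentOps ns v h
  eval-productₚ []       v h = trans (eval-constant elementOp-linear 1# v h) (*-identityˡ _)
  eval-productₚ (n ∷ ns) v h = begin
    eval elementOp (L n *ₚ productₚ (Vec.map L ns)) v h
      ≈⟨ eval-*ₚ elementOp-linear (L n) _ v h ⟩
    eval elementOp (L n) (eval elementOp (productₚ (Vec.map L ns)) v) h
      ≈⟨ eval-L n _ h ⟩
    segmentOp n (eval elementOp (productₚ (Vec.map L ns)) v) h
      ≈⟨ segmentOp-cong n (eval-productₚ ns v) h ⟩
    segmentOp n (segmentOps ns v) h ∎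

-- From permutations to matchings

tabulate-upFrom : ∀ t n → tabulate {n = n} (λ i → t ℕ.+ toℕ i) ≡ upFrom t n
tabulate-upFrom t zero    = ≡.refl
tabulate-upFrom t (suc n) = ≡.cong₂ _∷_ (ℕ.+-identityʳ t)
  (≡.trans (tabulate-cong (λ i → ℕ.+-suc t (toℕ i))) (tabulate-upFrom (suc t) n))

toℕ-segment : ∀ {k} (ns : Vec ℕ k) i → toℕ (segment ns i) ≡ segmentℕ ns (toℕ i)
toℕ-segment (n ∷ ns) i with splitAt n i in eq
... | inj₁ j = ≡.sym (choose-yes (toℕ i <? n)
  (≡.subst (_< n) (≡.trans (≡.sym (Fin.toℕ-↑ˡ j _)) (≡.cong toℕ (Fin.splitAt⁻¹-↑ˡ eq))) (Fin.toℕ<n j)))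
... | inj₂ j = ≡.sym (≡.trans (choose-no (toℕ i <? n) (λ i<n → ℕ.m+n≮m n (toℕ j) (≡.subst (_< n) i≡ i<n)))
  (≡.cong suc (≡.trans (≡.cong (segmentℕ ns) (≡.trans (≡.cong (ℕ._∸ n) i≡) (ℕ.m+n∸m≡n n (toℕ j))))
                       (≡.sym (toℕ-segment ns j)))))
  where
  i≡ : toℕ i ≡ n ℕ.+ toℕ j
  i≡ = ≡.trans (≡.cong toℕ (≡.sym (Fin.splitAt⁻¹-↑ʳ eq))) (Fin.toℕ-↑ʳ n j)

-- The labels are arbitrary because removing the first row and column j relabels the rest by `suc`
-- and `punchIn j`.
graph : ∀ {A B : Set} {n} → (Fin n → A) → (Fin n → B) → Permutation′ n → List (A × B)
graph ρ κ σ = tabulate (λ i → ρ i , κ (σ ⟨$⟩ʳ i))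

module PermutationSums {c ℓ : Level} (R : CommutativeRing c ℓ) where
  open CommutativeRing R hiding (zero) renaming (Carrier to K)
  open Sums R
  open import Relation.Binary.Reasoning.Setoid setoid

  ∑ : ∀ {A : Set} → List A → (A → K) → K
  ∑ xs F = List.foldr _+_ 0# (List.map F xs)

  ∑-cong : ∀ {A : Set} (xs : List A) {F G} → (∀ x → F x ≈ G x) → ∑ xs F ≈ ∑ xs G
  ∑-cong []       p = refl
  ∑-cong (x ∷ xs) p = +-cong (p x) (∑-cong xs p)

  ∑-filter : ∀ {A : Set} {P : A → Set} (P? : Decidable P) (F : A → K) (xs : List A) →
    ∑ (filter P? xs) F ≈ ∑ xs (λ x → choose (P? x) (F x) 0#)
  ∑-filter P? F []       = refl
  ∑-filter P? F (x ∷ xs) with P? x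
  ... | yes _ = +-congˡ (∑-filter P? F xs)
  ... | no  _ = trans (∑-filter P? F xs) (sym (+-identityˡ _))

  ∑-++ : ∀ {A : Set} (F : A → K) (xs ys : List A) → ∑ (xs ++ ys) F ≈ ∑ xs F + ∑ ys F
  ∑-++ F []       ys = sym (+-identityˡ _)
  ∑-++ F (x ∷ xs) ys = trans (+-congˡ (∑-++ F xs ys)) (sym (+-assoc _ _ _))

  ∑-map : ∀ {A B : Set} (F : B → K) (g : A → B) (xs : List A) → ∑ (List.map g xs) F ≡ ∑ xs (F ∘ g)
  ∑-map F g []       = ≡.refl
  ∑-map F g (x ∷ xs) = ≡.cong (F (g x) +_) (∑-map F g xs)

  ∑-cartesianProductWith : ∀ {A B C : Set} (F : C → K) (g : A → B → C) (xs : List A) (ys : List B) →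
    ∑ (cartesianProductWith g xs ys) F ≈ ∑ xs (λ x → ∑ ys (F ∘ g x))
  ∑-cartesianProductWith F g []       ys = refl
  ∑-cartesianProductWith F g (x ∷ xs) ys = trans (∑-++ F (List.map (g x) ys) _)
    (+-cong (reflexive (∑-map F (g x) ys)) (∑-cartesianProductWith F g xs ys))

  ∑pick-tabulate : ∀ {A : Set} {n} (κ : Fin (suc n) → A) (g : A → List A → K) →
    ∑pick (tabulate κ) g ≈ ∑ (allFin (suc n)) (λ j → g (κ j) (tabulate (κ ∘ punchIn j)))
  ∑pick-tabulate {n = zero}  κ g = refl
  ∑pick-tabulate {n = suc n} κ g = +-congˡ (begin
    ∑pick (tabulate (κ ∘ suc)) (λ z zs → g z (κ zero ∷ zs))
      ≈⟨ ∑pick-tabulate (κ ∘ suc) (λ z zs → g z (κ zero ∷ zs)) ⟩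
    ∑ (allFin (suc n)) (λ j → g (κ (suc j)) (κ zero ∷ tabulate (κ ∘ suc ∘ punchIn j)))
      ≡⟨ ∑-map _ suc (allFin (suc n)) ⟨
    ∑ (List.map suc (allFin (suc n))) (λ j → g (κ j) (tabulate (κ ∘ punchIn j)))
      ≡⟨ ≡.cong (λ js → ∑ js (λ j → g (κ j) (tabulate (κ ∘ punchIn j)))) (map-tabulate id suc) ⟩
    ∑ (tabulate suc) (λ j → g (κ j) (tabulate (κ ∘ punchIn j))) ∎)

  -- Both enumerations choose the image of the first row and then a bijection between the remaining
  -- elements.
  ∑-permutations : ∀ {A B : Set} {n} (ρ : Fin n → A) (κ : Fin n → B) (f : List (A × B) → K) →
    ∑ (permutations n) (f ∘ graph ρ κ) ≈ ∑match (tabulate ρ) (tabulate κ) f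
  ∑-permutations {n = zero}  ρ κ f = +-identityʳ _
  ∑-permutations {n = suc n} ρ κ f = begin
    ∑ (permutations (suc n)) (f ∘ graph ρ κ)
      ≈⟨ ∑-cartesianProductWith (f ∘ graph ρ κ) (insert zero) (allFin (suc n)) (permutations n) ⟩
    ∑ (allFin (suc n)) (λ j → ∑ (permutations n) (λ σ → f (graph ρ κ (insert zero j σ))))
      ≈⟨ ∑-cong (allFin (suc n)) (λ j → ∑-cong (permutations n) (λ σ → reflexive (≡.cong f
           (≡.cong ((ρ zero , κ j) ∷_) (tabulate-cong λ i → ≡.cong (λ k → ρ (suc i) , κ k) (insert-punchIn zero j σ i)))))) ⟩
    ∑ (allFin (suc n)) (λ j → ∑ (permutations n) (λ σ → f ((ρ zero , κ j) ∷ graph (ρ ∘ suc) (κ ∘ punchIn j) σ)))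
      ≈⟨ ∑-cong (allFin (suc n)) (λ j → ∑-permutations (ρ ∘ suc) (κ ∘ punchIn j) _) ⟩
    ∑ (allFin (suc n)) (λ j → ∑match (tabulate (ρ ∘ suc)) (tabulate (κ ∘ punchIn j)) (λ M → f ((ρ zero , κ j) ∷ M)))
      ≈⟨ ∑pick-tabulate κ (λ y ys → ∑match (tabulate (ρ ∘ suc)) ys (λ M → f ((ρ zero , y) ∷ M))) ⟨
    ∑match (tabulate ρ) (tabulate κ) f ∎

-- The weight of a permutation as the weight of its graph

module Weights {c ℓ : Level} (R : CommutativeRing c ℓ) (y q : CommutativeRing.Carrier R)
                (Forbidden : ℕ → ℕ → Set) (forbidden? : ∀ i j → Dec (Forbidden i j)) where
  open CommutativeRing R hiding (zero) renaming (Carrier to K)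
  open Sums R
  open PermutationSums R
  open Transfer R y q Forbidden forbidden?
  open import Algebra.Properties.Semiring.Exp semiring using (_^_; ^-homo-*)
  open import Algebra.Solver.Ring.NaturalCoefficients.Default commutativeSemiring
    using (solve; _:=_; _:+_; _:*_; con)
  open import Relation.Binary.Reasoning.Setoid setoid

  Π-cong′ : ∀ {A : Set} {f g : A → K} → (∀ x → f x ≈ g x) → ∀ xs → Π f xs ≈ Π g xs
  Π-cong′ p []       = refl
  Π-cong′ p (x ∷ xs) = *-cong (p x) (Π-cong′ p xs)

  Π-map : ∀ {A B : Set} (f : B → K) (g : A → B) (xs : List A) → Π f (List.map g xs) ≡ Π (f ∘ g) xs
  Π-map f g []       = ≡.refl
  Π-map f g (x ∷ xs) = ≡.cong (f (g x) *_) (Π-map f g xs)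

  Π-tabulate : ∀ {A : Set} {n} (f : A → K) (g : Fin n → A) → Π f (tabulate g) ≡ Π (f ∘ g) (allFin n)
  Π-tabulate f g = ≡.trans (≡.cong (Π f) (≡.sym (map-tabulate id g))) (Π-map f g (allFin _))

  ^-filter : ∀ {A : Set} {P : A → Set} (P? : Decidable P) x (xs : List A) →
             x ^ length (filter P? xs) ≈ Π (λ i → choose (P? i) x 1#) xs
  ^-filter P? x []       = refl
  ^-filter P? x (i ∷ xs) with P? i
  ... | yes _ = *-congˡ (^-filter P? x xs)
  ... | no  _ = trans (^-filter P? x xs) (sym (*-identityˡ _))

  ^-sum : ∀ {A : Set} (x : K) (u : A → ℕ) (xs : List A) → x ^ sum (List.map u xs) ≈ Π (λ i → x ^ u i) xs
  ^-sum x u []       = refl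
  ^-sum x u (i ∷ xs) = trans (^-homo-* x (u i) _) (*-congˡ (^-sum x u xs))

  χ-refl : ∀ e → χ e e ≈ 1#
  χ-refl (i , j) = trans (*-cong
    (reflexive (choose-no ((i <? i) ×-dec ((i ≤? j) ×-dec (j <? j))) (ℕ.<-irrefl ≡.refl ∘ proj₁)))
    (reflexive (choose-no ((i <? i) ×-dec ((j <? i) ×-dec (j <? j))) (ℕ.<-irrefl ≡.refl ∘ proj₁)))) (*-identityˡ 1#)

  -- One factor per unordered pair becomes a product over all ordered pairs, as in `cr`; the
  -- diagonal pairs contribute 1 by `χ-refl`.
  W-unfold : ∀ M → W 0 0 M ≈ Π edge M * Π (λ e → Π (χ e) M) M
  W-unfold []      = sym (*-identityˡ 1#)
  W-unfold (e ∷ M) = begin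
    live 0 0 e * Π (χ₂ e) M * W 0 0 M
      ≈⟨ *-cong (*-cong (live-1 0 0 (λ ())) (Π-* (χ e) (λ e′ → χ e′ e) M)) (W-unfold M) ⟩
    edge e * (Π (χ e) M * Π (λ e′ → χ e′ e) M) * (Π edge M * Π (λ e → Π (χ e) M) M)
      -- The factor `con 1` keeps the place of the diagonal term `χ e e`.
      ≈⟨ solve 5 (λ a b x d f → a :* (b :* x) :* (d :* f) := a :* d :* (con 1 :* b :* (x :* f))) refl
           (edge e) (Π (χ e) M) _ (Π edge M) _ ⟩
    edge e * Π edge M * (1# * Π (χ e) M * (Π (λ e′ → χ e′ e) M * Π (λ e → Π (χ e) M) M))
      ≈⟨ *-congˡ (*-cong (*-congʳ (sym (χ-refl e))) (sym (Π-* (λ e′ → χ e′ e) (λ e′ → Π (χ e′) M) M))) ⟩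
    edge e * Π edge M * (χ e e * Π (χ e) M * Π (λ e′ → χ e′ e * Π (χ e′) M) M) ∎

  module _ {n} (σ : Permutation′ n) where
    private
      e : Fin n → Edge
      e i = toℕ i , toℕ (σ ⟨$⟩ʳ i)

    ^-cr : q ^ cr σ ≈ Π (λ i → Π (λ j → χ (e i) (e j)) (allFin n)) (allFin n)
    ^-cr = begin
      q ^ (sum (List.map upper (allFin n)) ℕ.+ sum (List.map lower (allFin n)))
        ≈⟨ trans (^-homo-* q (sum (List.map upper (allFin n))) _)
             (*-cong (^-sum q upper (allFin n)) (^-sum q lower (allFin n))) ⟩
      Π (λ i → q ^ upper i) (allFin n) * Π (λ i → q ^ lower i) (allFin n)
        ≈⟨ *-cong (Π-cong′ (λ i → ^-filter (upper? i) q (allFin n)) (allFin n))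
                  (Π-cong′ (λ i → ^-filter (lower? i) q (allFin n)) (allFin n)) ⟩
      Π (λ i → Π (λ j → up (e j) (e i)) (allFin n)) (allFin n) * Π (λ i → Π (λ j → low (e i) (e j)) (allFin n)) (allFin n)
        ≈⟨ Π-* _ _ (allFin n) ⟨
      Π (λ i → Π (λ j → up (e j) (e i)) (allFin n) * Π (λ j → low (e i) (e j)) (allFin n)) (allFin n)
        ≈⟨ Π-cong′ (λ i → sym (Π-* _ _ (allFin n))) (allFin n) ⟩
      Π (λ i → Π (λ j → χ (e i) (e j)) (allFin n)) (allFin n) ∎
      where
      upper? = λ (i j : Fin n) →
        (j Fin.<? i) ×-dec ((i Fin.≤? (σ ⟨$⟩ʳ j)) ×-dec ((σ ⟨$⟩ʳ j) Fin.<? (σ ⟨$⟩ʳ i)))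
      lower? = λ (i j : Fin n) →
        (i Fin.<? j) ×-dec (((σ ⟨$⟩ʳ j) Fin.<? i) ×-dec ((σ ⟨$⟩ʳ i) Fin.<? (σ ⟨$⟩ʳ j)))
      upper lower : Fin n → ℕ
      upper i = count (upper? i)
      lower i = count (lower? i)

    W-graph : W 0 0 (graph toℕ toℕ σ) ≈ Π (edge ∘ e) (allFin n) * q ^ cr σ
    W-graph = begin
      W 0 0 (graph toℕ toℕ σ)
        ≈⟨ W-unfold (graph toℕ toℕ σ) ⟩
      Π edge (tabulate e) * Π (λ e′ → Π (χ e′) (tabulate e)) (tabulate e)
        ≈⟨ *-cong (reflexive (Π-tabulate edge e)) (trans (reflexive (Π-tabulate (λ e′ → Π (χ e′) (tabulate e)) e))
             (Π-cong′ (λ i → reflexive (Π-tabulate (χ (e i)) e)) (allFin n))) ⟩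
      Π (edge ∘ e) (allFin n) * Π (λ i → Π (λ j → χ (e i) (e j)) (allFin n)) (allFin n)
        ≈⟨ *-congˡ (sym ^-cr) ⟩
      Π (edge ∘ e) (allFin n) * q ^ cr σ ∎

    W-allowed : (∀ i → ¬ Forbidden (toℕ i) (toℕ (σ ⟨$⟩ʳ i))) → W 0 0 (graph toℕ toℕ σ) ≈ y ^ wex σ * q ^ cr σ
    W-allowed p = trans W-graph (*-congʳ (trans
      (Π-cong′ (λ i → reflexive (choose-no (forbidden? (toℕ i) (toℕ (σ ⟨$⟩ʳ i))) (p i))) (allFin n))
      (sym (^-filter _ y (allFin n)))))

    W-forbidden : ∀ i → Forbidden (toℕ i) (toℕ (σ ⟨$⟩ʳ i)) → W 0 0 (graph toℕ toℕ σ) ≈ 0#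
    W-forbidden i p = trans W-graph (trans (*-congʳ (trans (reflexive (≡.sym (Π-tabulate edge e))) (vanish e i
      (reflexive (choose-yes (forbidden? (toℕ i) (toℕ (σ ⟨$⟩ʳ i))) p))))) (zeroˡ _))
      where
      vanish : ∀ {n} (g : Fin n → Edge) i → edge (g i) ≈ 0# → Π edge (tabulate g) ≈ 0#
      vanish g zero    z = trans (*-congʳ z) (zeroˡ _)
      vanish g (suc i) z = trans (*-congˡ (vanish (g ∘ suc) i z)) (zeroʳ _)

  ∑-W : ∀ n → ∑ (permutations n) (λ σ → W 0 0 (graph toℕ toℕ σ)) ≈ Z 0 0 (upFrom 0 n ++ []) (upFrom 0 n ++ [])
  ∑-W n = trans (∑-permutations {n = n} toℕ toℕ (W 0 0))
    (reflexive (≡.cong (λ xs → Z 0 0 xs xs) (≡.trans (tabulate-upFrom 0 n) (≡.sym (++-identityʳ _)))))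

-- Both sides as values of operators at 0

module Main {c ℓ : Level} (R : CommutativeRing c ℓ) (P : Parameters R) where
  open CommutativeRing R hiding (zero) renaming (Carrier to K)
  open Parameters P
  open Polynomials R
  open QLaguerre R P
  open Evaluation R
  open Laguerre R P
  open Operators R y q
  open PermutationSums R
  open import Relation.Binary.Reasoning.Setoid setoid

  empty : Pending 0 [] []
  empty = record { new< = [] ; old< = [] ; decreasing = [] ; separated = [] }

  moment : ∀ n → totalWeight (permutations n) ≈ elementPower n δ 0
  moment n = begin
    ∑ (permutations n) weight
      ≈⟨ ∑-cong (permutations n) (λ σ → sym (W-allowed σ (λ _ ()))) ⟩
    _ ≈⟨ ∑-W n ⟩
    _ ≈⟨ Z-unrestricted n 0 empty empty ≡.refl ⟩
    elementPower n δ 0 ∎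
    where
    open Unrestricted R y q
    open Weights R y q (λ _ _ → ⊥) (λ _ _ → no λ ())

  ℒ-eval : ∀ f → ℒ f ≈ eval elementOp f δ 0
  ℒ-eval f = trans (linearFunctional-cong f moment) (sym (eval-linearFunctional f δ 0))

  -- Arcs inside a segment have weight 0, so the sum over derangements extends to all permutations.
  derangements : ∀ {k} (ns : Vec ℕ k) → totalWeight (𝒟 ns) ≈ segmentOps ns δ 0
  derangements ns = begin
    ∑ (𝒟 ns) weight
      ≈⟨ ∑-filter (isGeneralizedDerangement? ns) weight (permutations (Vec.sum ns)) ⟩
    ∑ (permutations (Vec.sum ns)) (λ σ → choose (isGeneralizedDerangement? ns σ) (weight σ) 0#)
      ≈⟨ ∑-cong (permutations (Vec.sum ns)) (λ σ → weight-W σ (isGeneralizedDerangement? ns σ)) ⟩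
    _ ≈⟨ ∑-W (Vec.sum ns) ⟩
    _ ≈⟨ Z-restricted ns 0 0 (λ _ → ≡.refl) block block ≡.refl ⟩
    segmentOps ns δ 0 ∎
    where
    seg = segmentℕ ns
    open Restricted R y q seg
    open Weights R y q (λ i j → seg i ≡ seg j) (λ i j → seg i ℕ.≟ seg j)
    open Transfer R y q (λ i j → seg i ≡ seg j) (λ i j → seg i ℕ.≟ seg j)

    block : Block 0 0 [] []
    block = record { pending = empty ; new-decreasing = [] ; new-segment = [] ; old-segment = [] }

    weight-W : ∀ σ (d : Dec (IsGeneralizedDerangement ns σ)) →
      choose d (weight σ) 0# ≈ W 0 0 (graph toℕ toℕ σ)
    weight-W σ (yes p) = sym (W-allowed σ λ i s → p i (Fin.toℕ-injective
      (≡.trans (toℕ-segment ns i) (≡.trans s (≡.sym (toℕ-segment ns (σ ⟨$⟩ʳ i)))))))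
    weight-W σ (no ¬p) = sym (W-forbidden σ (proj₁ bad) (≡.trans (≡.sym (toℕ-segment ns (proj₁ bad)))
      (≡.trans (≡.cong toℕ (decidable-stable (segment ns (proj₁ bad) Fin.≟ segment ns (σ ⟨$⟩ʳ proj₁ bad)) (proj₂ bad)))
               (toℕ-segment ns (σ ⟨$⟩ʳ proj₁ bad)))))
      where
      bad : ∃ λ i → ¬ (segment ns i ≢ segment ns (σ ⟨$⟩ʳ i))
      bad = Fin.¬∀⟶∃¬ _ _ (λ i → ¬? (segment ns i Fin.≟ segment ns (σ ⟨$⟩ʳ i))) ¬p

theorem5 : ∀ {c ℓ : Level} (R : CommutativeRing c ℓ) (P : Parameters R) →
    let open CommutativeRing R using (_≈_)
        open Polynomials R using (productₚ)
        open QLaguerre R P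
    in ∀ (k : ℕ) → k ≥ 1 → (ns : Vec ℕ k) →
       ℒ (productₚ (map L ns)) ≈ totalWeight (𝒟 ns)
theorem5 R P k _ ns = trans (ℒ-eval (productₚ (map L ns)))
  (trans (eval-productₚ ns δ 0) (sym (derangements ns)))
  where
  open CommutativeRing R using (trans; sym)
  open Polynomials R using (productₚ)
  open QLaguerre R P
  open Laguerre R P
  open Parameters P using (y; q)
  open Operators R y q using (δ)
  open Main R P
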